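{- Let $\Delta$ and $\Gamma$ be simplicial complexes with disjoint vertex sets. If $\Delta$ and $\Gamma$ each satisfy the spectral recursion, then so does their disjoint union $\Delta\cup\Gamma$ (a simplicial complex on the union of the two vertex sets).
   Context: A simplicial complex $\Delta$ on a finite vertex set $V$ is a collection of subsets of $V$ (faces) closed under taking subsets. The empty set is a face (of dimension $-1$) of every complex that has at least one face; the empty complex $\emptyset$ (no faces at all) is allowed; an element $v\in V$ need not satisfy $\{v\}\in\Delta$. In $\Delta\cup\Gamma$ the empty face is shared. Put $\dim F=|F|-1$. A simplicial pair $(\Delta,\Delta')$ consists of two simplicial complexes on the same vertex set; pairs with the same set difference $\Delta\setminus\Delta'$ are identified, and a single complex $\Delta$ is the pair $(\Delta,\emptyset)$. For $i\ge -1$, $C_i(\Delta,\Delta';\mathbb R)$ is the real vector space of formal linear combinations of oriented $i$-dimensional faces $[F]$, $F\in\Delta\setminus\Delta'$, and $\partial_i\colon C_i\to C_{i-1}$ is the usual signed simplicial boundary operator with all terms outside $\Delta\setminus\Delta'$ dropped; $\partial_i^*$ is its adjoint (transposed matrix in the natural bases). The Laplacian is $L_i(\Delta,\Delta')=\partial_{i+1}\partial_{i+1}^*+\partial_i^*\partial_i$, and $\mathbf s_i(\Delta,\Delta')$ is the multiset of its eigenvalues (non-negative reals). The spectrum polynomial is the generating function $$S_{(\Delta,\Delta')}(t,q)=\sum_{i\ge 0}t^i\sum_{\lambda\in\mathbf s_{i-1}(\Delta,\Delta')}q^\lambda,\qquad S_\Delta=S_{(\Delta,\emptyset)}$$ (exponents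 of $q$ may be arbitrary non-negative reals). For $e\in V$, the deletion $\Delta-e=\{F\in\Delta: e\notin F\}$ and the contraction $\Delta/e=\{F\setminus\{e\}: F\in\Delta,\ e\in F\}$ are simplicial complexes on vertex set $V\setminus\{e\}$. $\Delta$ satisfies the spectral recursion with respect to $e\in V$ if $$S_\Delta(t,q) = q\,S_{\Delta-e}(t,q) + qt\,S_{\Delta/e}(t,q) + (1-q)\,S_{(\Delta-e,\Delta/e)}(t,q),$$ and $\Delta$ satisfies the spectral recursion if this holds for every $e\in V$. -}

module Defs where

open import Algebra.Bundles using (CommutativeRing)
open import Data.Bool.Base using (if_then_else_)
import Data.Bool.Properties as Bool
open import Data.Empty using () renaming (⊥ to False)
open import Data.Fin.Base using (Fin; zero; suc; punchIn)
open import Data.Fin.Properties using (any?)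
open import Data.Fin.Subset
open import Data.Fin.Subset.Properties
open import Data.Integer.Base as ℤ using (ℤ; +_; _⊖_)
import Data.Integer.Properties as ℤ
open import Data.List.Base as List using (List; []; _∷_; _++_; foldr)
open import Data.List.Membership.Propositional using () renaming (_∈_ to _∈ˡ_)
open import Data.List.Membership.Propositional.Properties using (∈-++⁺ˡ; ∈-++⁺ʳ; ∈-map⁺)
open import Data.List.Relation.Unary.Any using (here; there)
open import Data.Nat.Base using (ℕ; zero; suc)
open import Data.Product.Base using (Σ; ∃; _×_; _,_; proj₁; proj₂)
open import Data.Sum.Base using (_⊎_; inj₁; inj₂)
open import Data.Vec.Base using ([]; _∷_; here; there)
open import Data.Vec.Functional using (Vector; insertAt; removeAt)
open import Data.Vec.Functional.Properties using (insertAt-lookup; insertAt-punchIn)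
import Data.Vec.Properties as Vec
open import Function.Base using (_∘_)
open import Level using (0ℓ)
open import Relation.Binary.Core using (Rel)
open import Relation.Binary.Definitions using (DecidableEquality)
open import Relation.Binary.PropositionalEquality as ≡ using (_≡_)
open import Relation.Binary.Structures using (IsStrictTotalOrder)
open import Relation.Nullary using (¬_; yes; no; does; contradiction)
open import Relation.Nullary.Decidable using (_×-dec_; _⊎-dec_; ¬?; decidable-stable)
open import Relation.Unary using (Pred; Decidable)

-- The real numbers are axiomatised as the complete ordered field,
-- which classically is unique up to isomorphism. The
-- mathematics is classical: the order is trichotomous and every nonempty
-- predicate that is bounded above has a least upper bound.

record CompleteOrderedField : Set₁ where
  field
    commutativeRing : CommutativeRing 0ℓ 0ℓ

  open CommutativeRing commutativeRing public

  infix 4 _<_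

  field
    _<_                : Rel Carrier 0ℓ
    isStrictTotalOrder : IsStrictTotalOrder _≈_ _<_
    0<1                : 0# < 1#
    +-monoˡ-<          : ∀ {x y} z → x < y → x + z < y + z
    *-pos              : ∀ {x y} → 0# < x → 0# < y → 0# < x * y
    inverse            : ∀ x → ¬ x ≈ 0# → ∃ λ y → x * y ≈ 1#

  UpperBound : Pred Carrier 0ℓ → Pred Carrier 0ℓ
  UpperBound P b = ∀ x → P x → ¬ b < x

  field
    supremum : ∀ (P : Pred Carrier 0ℓ) → ∃ P → ∃ (UpperBound P) →
               ∃ λ s → UpperBound P s × (∀ b → UpperBound P b → ¬ b < s)

  open IsStrictTotalOrder isStrictTotalOrder public using (compare; _≟_; _<?_)

-- Finite sets are subsets of an ambient Fin N. The order of Fin N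
-- serves to orient the faces. Face may hold for no set at all, for the
-- empty set only, and need not hold for singletons of V.

record Complex {N : ℕ} (V : Subset N) : Set₁ where
  field
    Face        : Pred (Subset N) 0ℓ
    Face?       : Decidable Face
    face⊆V      : ∀ {F} → Face F → F ⊆ V
    down-closed : ∀ {F G} → Face F → G ⊆ F → Face G

open Complex

module _ {N : ℕ} where

  infix 4 _≟ˢ_

  _≟ˢ_ : DecidableEquality (Subset N)
  _≟ˢ_ = Vec.≡-dec Bool._≟_

x∈p─q⇒x∉q : ∀ {n} (p q : Subset n) {x} → x ∈ p ─ q → x ∉ q
x∈p─q⇒x∉q (_ ∷ p) (_ ∷ q) (there x∈) (there x∈q) = x∈p─q⇒x∉q p q x∈ x∈q

⊆-delete : ∀ {n} {p q : Subset n} (e : Fin n) → p ⊆ q → e ∉ p → p ⊆ q - e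
⊆-delete e p⊆q e∉p x∈p =
  x∈p∧x≢y⇒x∈p-y (p⊆q x∈p) (λ { ≡.refl → e∉p x∈p })

delete-⊆ : ∀ {n} {p q : Subset n} (e : Fin n) → p ⊆ q → p - e ⊆ q - e
delete-⊆ {p = p} e p⊆q x∈ =
  x∈p∧x∉q⇒x∈p─q (p⊆q (p─q⊆p p ⁅ e ⁆ x∈)) (x∈p─q⇒x∉q p ⁅ e ⁆ x∈)

e∉p-e : ∀ {n} (p : Subset n) (e : Fin n) → e ∉ p - e
e∉p-e p e e∈ = x∈p─q⇒x∉q p ⁅ e ⁆ e∈ (x∈⁅x⁆ e)

∪⁅⁆-⊆ : ∀ {n} {p q : Subset n} (e : Fin n) → p ⊆ q → e ∈ q → p ∪ ⁅ e ⁆ ⊆ q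
∪⁅⁆-⊆ {p = p} e p⊆q e∈q x∈ with x∈p∪q⁻ p ⁅ e ⁆ x∈
... | inj₁ x∈p = p⊆q x∈p
... | inj₂ x∈e with ≡.refl ← x∈⁅y⁆⇒x≡y e x∈e = e∈q

insert-delete : ∀ {n} (p : Subset n) (e : Fin n) → e ∉ p → (p ∪ ⁅ e ⁆) - e ≡ p
insert-delete p e e∉p = ⊆-antisym left right
  where
  left : (p ∪ ⁅ e ⁆) - e ⊆ p
  left x∈ with x∈p∪q⁻ p ⁅ e ⁆ (p─q⊆p (p ∪ ⁅ e ⁆) ⁅ e ⁆ x∈)
  ... | inj₁ x∈p = x∈p
  ... | inj₂ x∈e = contradiction x∈e (x∈p─q⇒x∉q (p ∪ ⁅ e ⁆) ⁅ e ⁆ x∈)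
  right : p ⊆ (p ∪ ⁅ e ⁆) - e
  right = ⊆-delete e (p⊆p∪q ⁅ e ⁆) e∉p

module _ {N : ℕ} where

  ∅ᶜ : (V : Subset N) → Complex V
  ∅ᶜ V .Face        _  = False
  ∅ᶜ V .Face?       _  = no λ ()
  ∅ᶜ V .face⊆V      ()
  ∅ᶜ V .down-closed ()

  infixr 6 _∪ᶜ_

  _∪ᶜ_ : {V W : Subset N} → Complex V → Complex W → Complex (V ∪ W)
  (Δ ∪ᶜ Γ) .Face F = Face Δ F ⊎ Face Γ F
  (Δ ∪ᶜ Γ) .Face? F = Face? Δ F ⊎-dec Face? Γ F
  (Δ ∪ᶜ Γ) .face⊆V (inj₁ f) x∈F = x∈p∪q⁺ (inj₁ (face⊆V Δ f x∈F))
  (Δ ∪ᶜ Γ) .face⊆V (inj₂ f) x∈F = x∈p∪q⁺ (inj₂ (face⊆V Γ f x∈F))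
  (Δ ∪ᶜ Γ) .down-closed (inj₁ f) G⊆F = inj₁ (down-closed Δ f G⊆F)
  (Δ ∪ᶜ Γ) .down-closed (inj₂ f) G⊆F = inj₂ (down-closed Γ f G⊆F)

  deletion : {V : Subset N} → Complex V → (e : Fin N) → Complex (V - e)
  deletion Δ e .Face F = Face Δ F × e ∉ F
  deletion Δ e .Face? F = Face? Δ F ×-dec ¬? (e ∈? F)
  deletion Δ e .face⊆V (f , e∉F) = ⊆-delete e (face⊆V Δ f) e∉F
  deletion Δ e .down-closed (f , e∉F) G⊆F = down-closed Δ f G⊆F , λ e∈G → e∉F (G⊆F e∈G)

  contraction : {V : Subset N} → Complex V → (e : Fin N) → Complex (V - e)
  contraction Δ e .Face G = ∃ λ F → Face Δ F × e ∈ F × G ≡ F - e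
  contraction Δ e .Face? G =
    anySubset? λ F → Face? Δ F ×-dec (e ∈? F ×-dec G ≟ˢ F - e)
  contraction Δ e .face⊆V (F , f , e∈F , ≡.refl) = delete-⊆ e (face⊆V Δ f)
  contraction Δ e .down-closed {G = G} (F , f , e∈F , ≡.refl) G⊆ =
    G ∪ ⁅ e ⁆ ,
    down-closed Δ f (∪⁅⁆-⊆ e (λ x∈G → p─q⊆p F ⁅ e ⁆ (G⊆ x∈G)) e∈F) ,
    x∈p∪q⁺ (inj₂ (x∈⁅x⁆ e)) ,
    ≡.sym (insert-delete G e (λ e∈G → e∉p-e F e (G⊆ e∈G)))

Pair : {N : ℕ} → Subset N → Set₁
Pair V = Complex V × Complex V

dim : {N : ℕ} → Subset N → ℤ
dim F = ∣ F ∣ ⊖ 1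

module _ {N : ℕ} {V : Subset N} where

  IsFace : Pair V → ℤ → Pred (Subset N) 0ℓ
  IsFace (Δ , Δ′) i F = Face Δ F × ¬ Face Δ′ F × dim F ≡ i

  isFace? : (P : Pair V) (i : ℤ) → Decidable (IsFace P i)
  isFace? (Δ , Δ′) i F = Face? Δ F ×-dec (¬? (Face? Δ′ F) ×-dec dim F ℤ.≟ i)

allSubsets : (N : ℕ) → List (Subset N)
allSubsets zero    = [] ∷ []
allSubsets (suc N) =
  List.map (outside ∷_) (allSubsets N) ++ List.map (inside ∷_) (allSubsets N)

allSubsets-complete : ∀ {N} (F : Subset N) → F ∈ˡ allSubsets N
allSubsets-complete []            = here ≡.refl
allSubsets-complete (outside ∷ F) = ∈-++⁺ˡ (∈-map⁺ _ (allSubsets-complete F))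
allSubsets-complete (inside  ∷ F) =
  ∈-++⁺ʳ (List.map (outside ∷_) (allSubsets _)) (∈-map⁺ _ (allSubsets-complete F))

-- The number of elements of F that are smaller than v.
position : {N : ℕ} → Subset N → Fin N → ℕ
position (_       ∷ F) zero    = 0
position (inside  ∷ F) (suc v) = suc (position F v)
position (outside ∷ F) (suc v) = position F v

module LinearAlgebra (ℝ : CompleteOrderedField) where

  open CompleteOrderedField ℝ hiding (_-_; zero)
  open import Algebra.Properties.Ring ring using (-‿distribˡ-*; -‿distribʳ-*; +-inverseʳ-unique; -‿involutive)
  open import Algebra.Properties.Semiring.Sum semiring
    using (sum; sum-syntax; sum-cong-≋; sum-replicate-zero; ∑-distrib-+;
           *-distribʳ-sum; sum-remove)
  open import Relation.Binary.Reasoning.Setoid setoid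

  module _ {X : Set} where

    infix 4 _≋_

    _≋_ : Rel (X → Carrier) 0ℓ
    c ≋ d = ∀ x → c x ≈ d x

    combination : ∀ {n} → Vector Carrier n → Vector (X → Carrier) n → X → Carrier
    combination {n} a b x = ∑[ j < n ] (a j * b j x)

    record Basis (P : Pred (X → Carrier) 0ℓ) (n : ℕ) : Set where
      field
        vectors     : Vector (X → Carrier) n
        member      : ∀ j → P (vectors j)
        independent : ∀ a → combination a vectors ≋ (λ _ → 0#) → ∀ j → a j ≈ 0#
        spanning    : ∀ c → P c → ∃ λ a → c ≋ combination a vectors

    record IsSubspace (P : Pred (X → Carrier) 0ℓ) : Set where
      field
        add   : ∀ {c d} → P c → P d → P (λ x → c x + d x)
        scale : ∀ r {c} → P c → P (λ x → r * c x)

    record IsLinear (φ : (X → Carrier) → Carrier) : Set where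
      field
        φ-cong  : ∀ {c d} → c ≋ d → φ c ≈ φ d
        φ-add   : ∀ c d → φ (λ x → c x + d x) ≈ φ c + φ d
        φ-scale : ∀ r c → φ (λ x → r * c x) ≈ r * φ c

    module _ {φ} (lin : IsLinear φ) where
      open IsLinear lin

      φ-zero : φ (λ _ → 0#) ≈ 0#
      φ-zero = begin
        φ (λ _ → 0#)       ≈⟨ φ-cong (λ _ → sym (zeroˡ 0#)) ⟩
        φ (λ _ → 0# * 0#)  ≈⟨ φ-scale 0# _ ⟩
        0# * φ (λ _ → 0#)  ≈⟨ zeroˡ _ ⟩
        0#                 ∎

      φ-combination : ∀ {n} (a : Vector Carrier n) b →
                      φ (combination a b) ≈ ∑[ j < n ] (a j * φ (b j))
      φ-combination {zero}  a b = φ-zero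
      φ-combination {suc n} a b =
        trans (φ-add _ _) (+-cong (φ-scale _ _) (φ-combination (a ∘ suc) (b ∘ suc)))

    module Cut {P : Pred (X → Carrier) 0ℓ} (sub : IsSubspace P)
               {φ : (X → Carrier) → Carrier} (lin : IsLinear φ) where
      open IsSubspace sub
      open IsLinear lin

      Q : Pred (X → Carrier) 0ℓ
      Q c = P c × φ c ≈ 0#

      trivial : ∀ {n} (B : Basis P n) → (∀ j → φ (Basis.vectors B j) ≈ 0#) → Basis Q n
      trivial B φb≈0 = record
        { vectors     = vectors
        ; member      = λ j → member j , φb≈0 j
        ; independent = independent
        ; spanning    = λ c Qc → spanning c (proj₁ Qc)
        }
        where open Basis B

      module _ {n} (B : Basis P (suc n)) (k : Fin (suc n)) where
        open Basis B renaming (vectors to b)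

        module _ (p⁻¹ : Carrier) (pp⁻¹≈1 : φ (b k) * p⁻¹ ≈ 1#) where

          b∖k : Vector (X → Carrier) n
          b∖k j = b (punchIn k j)

          r : Vector Carrier n
          r j = - (φ (b∖k j) * p⁻¹)

          b′ : Vector (X → Carrier) n
          b′ j x = b∖k j x + r j * b k x

          S : Vector Carrier n → Carrier
          S a = ∑[ j < n ] (a j * r j)

          r-cancel : ∀ j → φ (b∖k j) + r j * φ (b k) ≈ 0#
          r-cancel j = begin
            φj + - (φj * p⁻¹) * φk   ≈⟨ +-congˡ (-‿distribˡ-* _ _) ⟨
            φj + - (φj * p⁻¹ * φk)   ≈⟨ +-congˡ (-‿cong (*-assoc _ _ _)) ⟩
            φj + - (φj * (p⁻¹ * φk)) ≈⟨ +-congˡ (-‿cong (*-congˡ (trans (*-comm _ _) pp⁻¹≈1))) ⟩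
            φj + - (φj * 1#)         ≈⟨ +-congˡ (-‿cong (*-identityʳ _)) ⟩
            φj + - φj                ≈⟨ -‿inverseʳ _ ⟩
            0#                       ∎
            where
            φj = φ (b∖k j)
            φk = φ (b k)

          combination-b : ∀ a x → combination a b x ≈ a k * b k x + combination (removeAt a k) b∖k x
          combination-b a x = sum-remove {i = k} (λ j → a j * b j x)

          combination-b′ : ∀ a x → combination a b′ x ≈ S a * b k x + combination a b∖k x
          combination-b′ a x = begin
            ∑[ j < n ] (a j * (b∖k j x + r j * b k x))
              ≈⟨ sum-cong-≋ (λ j → trans (distribˡ (a j) _ _) (+-congˡ (sym (*-assoc (a j) (r j) (b k x))))) ⟩
            ∑[ j < n ] (a j * b∖k j x + a j * r j * b k x)
              ≈⟨ ∑-distrib-+ (λ j → a j * b∖k j x) (λ j → a j * r j * b k x) ⟩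
            combination a b∖k x + ∑[ j < n ] (a j * r j * b k x)
              ≈⟨ +-congˡ (*-distribʳ-sum (b k x) (λ j → a j * r j)) ⟨
            combination a b∖k x + S a * b k x
              ≈⟨ +-comm _ _ ⟩
            S a * b k x + combination a b∖k x ∎

          member′ : ∀ j → Q (b′ j)
          member′ j = add (member _) (scale _ (member k)) ,
                      trans (trans (φ-add _ _) (+-congˡ (φ-scale _ _))) (r-cancel j)

          independent′ : ∀ a → combination a b′ ≋ (λ _ → 0#) → ∀ j → a j ≈ 0#
          independent′ a zero-comb j =
            trans (sym (reflexive (insertAt-punchIn a k (S a) j)))
                  (independent A A-zero (punchIn k j))
            where
            A = insertAt a k (S a)
            A-zero : combination A b ≋ (λ _ → 0#)
            A-zero x = begin
              combination A b x
                ≈⟨ combination-b A x ⟩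
              A k * b k x + combination (removeAt A k) b∖k x
                ≈⟨ +-cong (*-congʳ (reflexive (insertAt-lookup a k (S a))))
                          (sum-cong-≋ (λ i → *-congʳ (reflexive (insertAt-punchIn a k (S a) i)))) ⟩
              S a * b k x + combination a b∖k x
                ≈⟨ combination-b′ a x ⟨
              combination a b′ x
                ≈⟨ zero-comb x ⟩
              0# ∎

          spanning′ : ∀ c → Q c → ∃ λ a → c ≋ combination a b′
          spanning′ c (Pc , φc≈0) with spanning c Pc
          ... | a , c≋ab = a∖k , λ x → begin
                c x
                  ≈⟨ c≋ab x ⟩
                combination a b x
                  ≈⟨ combination-b a x ⟩
                a k * b k x + combination a∖k b∖k x
                  ≈⟨ +-congʳ (*-congʳ S≈ak) ⟨
                S a∖k * b k x + combination a∖k b∖k x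
                  ≈⟨ combination-b′ a∖k x ⟨
                combination a∖k b′ x ∎
            where
            a∖k = removeAt a k
            T   = ∑[ j < n ] (a∖k j * φ (b∖k j))
            relation : a k * φ (b k) + T ≈ 0#
            relation = begin
              a k * φ (b k) + T
                ≈⟨ sum-remove {i = k} (λ j → a j * φ (b j)) ⟨
              ∑[ j < suc n ] (a j * φ (b j))
                ≈⟨ φ-combination lin a b ⟨
              φ (combination a b)
                ≈⟨ φ-cong c≋ab ⟨
              φ c
                ≈⟨ φc≈0 ⟩
              0# ∎
            S≈ak : S a∖k ≈ a k
            S≈ak = begin
              ∑[ j < n ] (a∖k j * - (φ (b∖k j) * p⁻¹))
                ≈⟨ sum-cong-≋ (λ j → *-congˡ (-‿distribʳ-* (φ (b∖k j)) p⁻¹)) ⟩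
              ∑[ j < n ] (a∖k j * (φ (b∖k j) * - p⁻¹))
                ≈⟨ sum-cong-≋ (λ j → *-assoc (a∖k j) (φ (b∖k j)) (- p⁻¹)) ⟨
              ∑[ j < n ] (a∖k j * φ (b∖k j) * - p⁻¹)
                ≈⟨ *-distribʳ-sum (- p⁻¹) (λ j → a∖k j * φ (b∖k j)) ⟨
              T * - p⁻¹
                ≈⟨ *-congʳ (+-inverseʳ-unique _ _ relation) ⟩
              - (a k * φ (b k)) * - p⁻¹
                ≈⟨ -‿distribˡ-* _ _ ⟨
              - (a k * φ (b k) * - p⁻¹)
                ≈⟨ -‿distribʳ-* _ _ ⟩
              a k * φ (b k) * - - p⁻¹
                ≈⟨ *-congˡ (-‿involutive p⁻¹) ⟩
              a k * φ (b k) * p⁻¹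
                ≈⟨ *-assoc _ _ _ ⟩
              a k * (φ (b k) * p⁻¹)
                ≈⟨ *-congˡ pp⁻¹≈1 ⟩
              a k * 1#
                ≈⟨ *-identityʳ _ ⟩
              a k ∎

          reduced : Basis Q n
          reduced = record
            { vectors = b′ ; member = member′
            ; independent = independent′ ; spanning = spanning′ }

      cut : Σ ℕ (Basis P) → Σ ℕ (Basis Q)
      cut (n , B) with any? (λ j → ¬? (φ (Basis.vectors B j) ≟ 0#))
      ... | no  none    = n , trivial B (λ j → decidable-stable (_ ≟ 0#) (λ ne → none (j , ne)))
      cut (suc n , B) | yes (k , ne) with inverse _ ne
      ... | p⁻¹ , eq = n , reduced B k p⁻¹ eq

    transport : ∀ {P Q : Pred (X → Carrier) 0ℓ} → (∀ {c} → P c → Q c) → (∀ {c} → Q c → P c) →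
                Σ ℕ (Basis P) → Σ ℕ (Basis Q)
    transport P⇒Q Q⇒P (n , B) = n , record
      { vectors     = vectors
      ; member      = λ j → P⇒Q (member j)
      ; independent = independent
      ; spanning    = λ c Qc → spanning c (Q⇒P Qc)
      }
      where open Basis B

    solve : ∀ {I : Set} {P : Pred (X → Carrier) 0ℓ} → IsSubspace P →
            (φ : I → (X → Carrier) → Carrier) → (∀ i → IsLinear (φ i)) → (is : List I) →
            Σ ℕ (Basis P) → Σ ℕ (Basis (λ c → P c × (∀ i → i ∈ˡ is → φ i c ≈ 0#)))
    solve sub φ lin [] B = transport (λ Pc → Pc , λ _ ()) proj₁ B
    solve {I} {P} sub φ lin (i ∷ is) B =
      transport
        (λ { ((Pc , φc≈0) , rest) → Pc , λ { _ (here ≡.refl) → φc≈0 ; j (there j∈) → rest j j∈ } })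
        (λ { (Pc , all) → (Pc , all i (here ≡.refl)) , λ j j∈ → all j (there j∈) })
        (solve sub′ φ lin is (Cut.cut sub (lin i) B))
      where
      open IsSubspace sub
      open IsLinear (lin i)
      sub′ : IsSubspace (λ c → P c × φ i c ≈ 0#)
      sub′ = record
        { add   = λ { (Pc , φc) (Pd , φd) → add Pc Pd , trans (φ-add _ _) (trans (+-cong φc φd) (+-identityˡ 0#)) }
        ; scale = λ { s (Pc , φc) → scale s Pc , trans (φ-scale _ _) (trans (*-congˡ φc) (zeroʳ s)) }
        }

    module Supported (_≟ˣ_ : DecidableEquality X) where
      open import Data.List.Membership.DecPropositional _≟ˣ_ using () renaming (_∈?_ to _∈ˡ?_)

      SupportedOn : List X → Pred (X → Carrier) 0ℓ
      SupportedOn xs c = ∀ x → ¬ x ∈ˡ xs → c x ≈ 0#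

      δ : X → X → Carrier
      δ x y = if does (x ≟ˣ y) then 1# else 0#

      δ-diag : ∀ x → δ x x ≈ 1#
      δ-diag x with x ≟ˣ x
      ... | yes _ = refl
      ... | no ne = contradiction ≡.refl ne

      δ-off : ∀ {x y} → ¬ x ≡ y → δ x y ≈ 0#
      δ-off {x} {y} ne with x ≟ˣ y
      ... | yes eq = contradiction eq ne
      ... | no _   = refl

      supported-basis : ∀ xs → Σ ℕ (Basis (SupportedOn xs))
      supported-basis [] = 0 , record
        { vectors     = λ ()
        ; member      = λ ()
        ; independent = λ _ _ ()
        ; spanning    = λ c z → (λ ()) , λ x → z x (λ ())
        }
      supported-basis (x ∷ xs) with x ∈ˡ? xs | supported-basis xs
      ... | yes x∈xs | B = transport
              (λ z y y∉ → z y (λ y∈ → y∉ (there y∈)))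
              (λ z y y∉ → z y (λ { (here ≡.refl) → y∉ x∈xs ; (there y∈) → y∉ y∈ }))
              B
      ... | no x∉xs | n , B = suc n , record
              { vectors     = b′
              ; member      = λ { zero y y∉ → δ-off (λ { ≡.refl → y∉ (here ≡.refl) })
                                ; (suc j) y y∉ → member j y (λ y∈ → y∉ (there y∈)) }
              ; independent = ind
              ; spanning    = span
              }
        where
        open Basis B
        b′ : Vector (X → Carrier) (suc n)
        b′ zero    = δ x
        b′ (suc j) = vectors j
        vanish : ∀ a → combination a vectors x ≈ 0#
        vanish a = trans (sum-cong-≋ (λ j → trans (*-congˡ (member j x x∉xs)) (zeroʳ _)))
                         (sum-replicate-zero n)
        ind : ∀ a → combination a b′ ≋ (λ _ → 0#) → ∀ j → a j ≈ 0#
        ind a z = λ { zero → a₀≈0 ; (suc j) → independent (a ∘ suc) rest j }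
          where
          a₀≈0 : a zero ≈ 0#
          a₀≈0 = begin
            a zero                                                   ≈⟨ *-identityʳ _ ⟨
            a zero * 1#                                              ≈⟨ *-congˡ (δ-diag x) ⟨
            a zero * δ x x                                           ≈⟨ +-identityʳ _ ⟨
            a zero * δ x x + 0#                                      ≈⟨ +-congˡ (vanish (a ∘ suc)) ⟨
            a zero * δ x x + combination (a ∘ suc) vectors x         ≈⟨ z x ⟩
            0#                                                       ∎
          rest : combination (a ∘ suc) vectors ≋ (λ _ → 0#)
          rest y = begin
            combination (a ∘ suc) vectors y                          ≈⟨ +-identityˡ _ ⟨
            0# + combination (a ∘ suc) vectors y                     ≈⟨ +-congʳ (trans (*-congʳ a₀≈0) (zeroˡ _)) ⟨
            a zero * δ x y + combination (a ∘ suc) vectors y         ≈⟨ z y ⟩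
            0#                                                       ∎
        span : ∀ c → SupportedOn (x ∷ xs) c → ∃ λ a → c ≋ combination a b′
        span c supp = a , eq
          where
          d : X → Carrier
          d y = c y + - (c x * δ x y)
          d-supp : SupportedOn xs d
          d-supp y y∉ with x ≟ˣ y
          ... | yes ≡.refl = trans (+-congˡ (-‿cong (*-identityʳ _))) (-‿inverseʳ _)
          ... | no x≢y = begin
            c y + - (c x * 0#)  ≈⟨ +-cong (supp y (λ { (here e) → x≢y (≡.sym e) ; (there y∈) → y∉ y∈ }))
                                         (-‿cong (zeroʳ _)) ⟩
            0# + - 0#           ≈⟨ -‿inverseʳ 0# ⟩
            0#                  ∎
          sp = spanning d d-supp
          a : Vector Carrier (suc n)
          a zero    = c x
          a (suc j) = proj₁ sp j
          eq : c ≋ combination a b′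
          eq y = begin
            c y                                          ≈⟨ +-identityʳ _ ⟨
            c y + 0#                                     ≈⟨ +-congˡ (-‿inverseˡ _) ⟨
            c y + (- (c x * δ x y) + c x * δ x y)        ≈⟨ +-assoc _ _ _ ⟨
            d y + c x * δ x y                            ≈⟨ +-comm _ _ ⟩
            c x * δ x y + d y                            ≈⟨ +-congˡ (proj₂ sp y) ⟩
            c x * δ x y + combination (proj₁ sp) vectors y ∎

module Spectrum (ℝ : CompleteOrderedField) where

  open CompleteOrderedField ℝ hiding (_-_; zero)
  open LinearAlgebra ℝ
  open import Algebra.Properties.Ring ring using (-‿distribˡ-*)
  open import Algebra.Properties.Semiring.Exp semiring using (_^_)
  open import Algebra.Properties.Semiring.Sum semiring using (sum-syntax)
  open import Algebra.Properties.CommutativeSemigroup +-commutativeSemigroup using (interchange)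
  open import Algebra.Properties.CommutativeSemigroup *-commutativeSemigroup using (x∙yz≈y∙xz)
  open import Relation.Binary.Reasoning.Setoid setoid

  module _ {N : ℕ} where

    ∑ˢ : (Subset N → Carrier) → Carrier
    ∑ˢ f = foldr (λ F s → f F + s) 0# (allSubsets N)

    -- Matrices with rows and columns indexed by all subsets of Fin N.
    -- The matrix of an operator between chain groups has zero entries
    -- outside the rows and columns of the faces in question.
    Matrix : Set
    Matrix = Subset N → Subset N → Carrier

    _ᵀ : Matrix → Matrix
    (A ᵀ) F G = A G F

    infixl 7 _⊗_

    _⊗_ : Matrix → Matrix → Matrix
    (A ⊗ B) F G = ∑ˢ λ H → A F H * B H G

    _·_ : Matrix → (Subset N → Carrier) → Subset N → Carrier
    (A · c) F = ∑ˢ λ G → A F G * c G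

    -- The coefficient of [G] in Σ_{v ∈ F} (-1)^(position of v in F) [F - v].
    incidence : Matrix
    incidence G F = ∑[ v < N ]
      (if does (v ∈? F ×-dec G ≟ˢ F - v) then (- 1#) ^ position F v else 0#)

  module _ {N : ℕ} {V : Subset N} (P : Pair V) where

    Chain : ℤ → Pred (Subset N → Carrier) 0ℓ
    Chain i c = ∀ F → ¬ IsFace P i F → c F ≈ 0#

    -- Column F and row G of the matrix of ∂ i : Chain i → Chain (i - 1).
    ∂ : ℤ → Matrix
    ∂ i G F = if does (isFace? P (i ℤ.- ℤ.1ℤ) G ×-dec isFace? P i F)
              then incidence G F else 0#

    Laplacian : ℤ → Matrix
    Laplacian i F G = (∂ (i ℤ.+ ℤ.1ℤ) ⊗ ∂ (i ℤ.+ ℤ.1ℤ) ᵀ) F G + (∂ i ᵀ ⊗ ∂ i) F G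

    Eigenspace : ℤ → Carrier → Pred (Subset N → Carrier) 0ℓ
    Eigenspace i l c = Chain i c × (∀ F → (Laplacian i · c) F ≈ l * c F)

  private
    module Sums {X : Set} where
      ∑ : List X → (X → Carrier) → Carrier
      ∑ xs f = foldr (λ x s → f x + s) 0# xs

      ∑-cong : ∀ xs {f g} → f ≋ g → ∑ xs f ≈ ∑ xs g
      ∑-cong []       f≋g = refl
      ∑-cong (x ∷ xs) f≋g = +-cong (f≋g x) (∑-cong xs f≋g)

      ∑-+ : ∀ xs f g → ∑ xs (λ x → f x + g x) ≈ ∑ xs f + ∑ xs g
      ∑-+ []       f g = sym (+-identityˡ 0#)
      ∑-+ (x ∷ xs) f g = trans (+-congˡ (∑-+ xs f g)) (interchange _ _ _ _)

      ∑-* : ∀ xs r f → ∑ xs (λ x → r * f x) ≈ r * ∑ xs f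
      ∑-* []       r f = sym (zeroʳ r)
      ∑-* (x ∷ xs) r f = trans (+-congˡ (∑-* xs r f)) (sym (distribˡ _ _ _))

  module _ {N : ℕ} {V : Subset N} (P : Pair V) (i : ℤ) (l : Carrier) where

    private
      L = Laplacian P i
      open Sums

      φ : Subset N → (Subset N → Carrier) → Carrier
      φ F c = (L · c) F + (- l) * c F

      φ-linear : ∀ F → IsLinear (φ F)
      φ-linear F = record
        { φ-cong  = λ c≋d → +-cong (∑-cong xs (λ G → *-congˡ (c≋d G))) (*-congˡ (c≋d F))
        ; φ-add   = λ c d → trans
            (+-cong (trans (∑-cong xs (λ G → distribˡ _ _ _)) (∑-+ xs _ _)) (distribˡ _ _ _))
            (interchange _ _ _ _)
        ; φ-scale = λ r c → trans
            (+-cong (trans (∑-cong xs (λ G → x∙yz≈y∙xz _ _ _)) (∑-* xs r _)) (x∙yz≈y∙xz _ _ _))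
            (sym (distribˡ _ _ _))
        }
        where xs = allSubsets N

      chain-subspace : IsSubspace (Chain P i)
      chain-subspace = record
        { add   = λ zc zd F nf → trans (+-cong (zc F nf) (zd F nf)) (+-identityˡ 0#)
        ; scale = λ r zc F nf → trans (*-congˡ (zc F nf)) (zeroʳ r)
        }

      φ⇒eigen : ∀ {x y} → x + (- l) * y ≈ 0# → x ≈ l * y
      φ⇒eigen {x} {y} e = begin
        x                        ≈⟨ +-identityʳ x ⟨
        x + 0#                   ≈⟨ +-congˡ (-‿inverseˡ (l * y)) ⟨
        x + (- (l * y) + l * y)  ≈⟨ +-assoc _ _ _ ⟨
        x + - (l * y) + l * y    ≈⟨ +-congʳ (+-congˡ (-‿distribˡ-* l y)) ⟩
        x + (- l) * y + l * y    ≈⟨ +-congʳ e ⟩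
        0# + l * y               ≈⟨ +-identityˡ _ ⟩
        l * y                    ∎

      eigen⇒φ : ∀ {x y} → x ≈ l * y → x + (- l) * y ≈ 0#
      eigen⇒φ {x} {y} e = begin
        x + (- l) * y        ≈⟨ +-congˡ (-‿distribˡ-* l y) ⟨
        x + - (l * y)        ≈⟨ +-congʳ e ⟩
        l * y + - (l * y)    ≈⟨ -‿inverseʳ _ ⟩
        0#                   ∎

    abstract
      eigenbasis : Σ ℕ (Basis (Eigenspace P i l))
      eigenbasis = transport
        (λ { (ch , eqs) → ch , λ F → φ⇒eigen (eqs F (allSubsets-complete F)) })
        (λ { (ch , eig) → ch , λ F _ → eigen⇒φ (eig F) })
        (solve chain-subspace φ φ-linear (allSubsets N) chains)
        where
        open import Data.List.Membership.Propositional.Properties using (∈-filter⁺; ∈-filter⁻)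
        open Supported _≟ˢ_
        faces : List (Subset N)
        faces = List.filter (isFace? P i) (allSubsets N)
        chains : Σ ℕ (Basis (Chain P i))
        chains = transport
          (λ z F nf → z F (λ F∈ → nf (proj₂ (∈-filter⁻ (isFace? P i) {xs = allSubsets N} F∈))))
          (λ z F F∉ → z F (λ f → F∉ (∈-filter⁺ (isFace? P i) (allSubsets-complete F) f)))
          (supported-basis faces)

    -- L is symmetric, so the multiplicity of l in the multiset of
    -- eigenvalues is the dimension of the eigenspace, zero if l is
    -- not an eigenvalue.
    multiplicity : ℕ
    multiplicity = proj₁ eigenbasis

  -- Formal sums of monomials a tᵏ q^l with k ∈ ℕ, l ∈ ℝ and a ∈ ℤ;
  -- such a sum is the function sending k and l to the coefficient.
  GeneratingFunction : Set
  GeneratingFunction = ℕ → Carrier → ℤ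

  infixr 8 q·_ t·_ [1-q]·_
  infixl 6 _⊕_
  infix  4 _≐_

  _≐_ : Rel GeneratingFunction 0ℓ
  f ≐ g = ∀ k l → f k l ≡ g k l

  _⊕_ : GeneratingFunction → GeneratingFunction → GeneratingFunction
  (f ⊕ g) k l = f k l ℤ.+ g k l

  q·_ : GeneratingFunction → GeneratingFunction
  (q· f) k l = f k (l + - 1#)

  t·_ : GeneratingFunction → GeneratingFunction
  (t· f) zero    l = ℤ.0ℤ
  (t· f) (suc k) l = f k l

  [1-q]·_ : GeneratingFunction → GeneratingFunction
  ([1-q]· f) k l = f k l ℤ.- (q· f) k l

  spectrumPolynomial : {N : ℕ} {V : Subset N} → Pair V → GeneratingFunction
  spectrumPolynomial P k l = + multiplicity P (k ⊖ 1) l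

  spectrumPolynomialᶜ : {N : ℕ} {V : Subset N} → Complex V → GeneratingFunction
  spectrumPolynomialᶜ {V = V} Δ = spectrumPolynomial (Δ , ∅ᶜ V)

  SpectralRecursionAt : {N : ℕ} {V : Subset N} → Complex V → Fin N → Set
  SpectralRecursionAt Δ e =
    spectrumPolynomialᶜ Δ ≐
      q· spectrumPolynomialᶜ (deletion Δ e)
      ⊕ q· t· spectrumPolynomialᶜ (contraction Δ e)
      ⊕ [1-q]· spectrumPolynomial (deletion Δ e , contraction Δ e)

  SpectralRecursion : {N : ℕ} {V : Subset N} → Complex V → Set
  SpectralRecursion {V = V} Δ = ∀ e → e ∈ V → SpectralRecursionAt Δ e

{-# OPTIONS --safe #-}
module Submission where

-- If {e} is not a face of Δ ∪ Γ the recursion at e is immediate. Otherwise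
-- {e} is a face of Δ, say. Nonempty faces of Δ and of Γ are never incident,
-- so away from the empty face all Laplacians are block diagonal and
-- multiplicities add up. The relative complex of deletion and contraction
-- does not contain the empty face, so this settles it. In the Laplacian L₀
-- of a complex with n vertices the empty face contributes the all-ones
-- matrix, which shifts the eigenvalue of the all-ones vector from 0 to n,
-- and L₋₁ = n. Hence the multiplicity of l in L₀ exceeds that without the
-- empty face by [l = n] - [l = 0], and [l = n] is the multiplicity of l
-- in L₋₁. This correction is compatible with the recursion since deleting e
-- lowers n by one.

-- `multiplicity` is the size of a basis found by an abstract elimination procedure, so it can never
-- be computed. An equation between multiplicities is therefore proved by exhibiting two bases of
-- one eigenspace and invoking uniqueness of dimension. Nothing is diagonalised. Block structure
-- becomes a direct sum of eigenspaces for a fixed eigenvalue, and the rank one change of L₀ becomes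
-- a comparison with a hyperplane. That comparison works because the all-ones vector `u` on the
-- vertices is harmonic once the empty face is gone. By symmetry the functional `ρ` (inner product
-- with `u`) then kills the image of the smaller Laplacian. Hence eigenvectors of either L₀ lie in
-- the kernel of `ρ`, where the two operators agree, except for the eigenvalues 0 and n
-- respectively. The term [l = 0] is never evaluated. It occurs alike for Δ and for the union, so
-- subtracting the two equations removes it, and with it the multiplicities of Δ without its empty
-- face.

open import Defs
open import Algebra.Properties.CommutativeSemigroup using (x∙yz≈y∙xz)
open import Data.Bool.Base using (if_then_else_)
open import Data.Fin.Base using (Fin; zero; suc; splitAt; join; _↑ˡ_; _↑ʳ_)
import Data.Fin.Properties as Fin
open import Data.Fin.Properties using (any?; join-splitAt)
open import Data.Fin.Subset
open import Data.Fin.Subset.Properties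
open import Data.Integer.Base as ℤ using (ℤ; +_; _⊖_)
import Data.Integer.Properties as ℤ
import Data.Integer.Solver as ℤ
open import Data.List.Base as List using (List; []; _∷_; foldr)
open import Data.List.Membership.Propositional using () renaming (_∈_ to _∈ˡ_)
import Data.List.Relation.Unary.Any as Any
open import Data.Nat.Base as ℕ using (ℕ; zero; suc)
import Data.Nat.Properties as ℕ
open import Data.Product.Base using (∃; _×_; _,_; proj₁; proj₂)
open import Data.Sum.Base as Sum using (_⊎_; inj₁; inj₂)
open import Data.Unit.Base using (tt) renaming (⊤ to Unit)
open import Data.Vec.Base using ([]; _∷_; here; there)
open import Data.Vec.Functional as Vector using (Vector)
open import Data.Vec.Functional.Properties using (lookup-++ˡ; lookup-++ʳ)
open import Function.Base using (_∘_; id)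
open import Level using (0ℓ)
open import Relation.Binary.PropositionalEquality as ≡ using (_≡_)
open import Relation.Binary.Structures using (IsStrictTotalOrder)
open import Relation.Nullary using (Dec; ¬_; yes; no; does; contradiction)
open import Relation.Nullary.Decidable using (_×-dec_; ¬?; decidable-stable)
open import Relation.Unary using (Pred; Decidable)

open Complex

-- Linear algebra: direct sums, hyperplanes and uniqueness of dimension.

module Dimension (ℝ : CompleteOrderedField) where

  open CompleteOrderedField ℝ hiding (_-_; zero)
  open LinearAlgebra ℝ
  open import Algebra.Properties.Semiring.Sum semiring
    using (sum; sum-syntax; sum-cong-≋; sum-replicate-zero; ∑-comm; ∑-distrib-+; sum-remove; *-distribˡ-sum; *-distribʳ-sum)
  open import Relation.Binary.Reasoning.Setoid setoid
  open IsStrictTotalOrder isStrictTotalOrder using (irrefl)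

  1≉0 : ¬ 1# ≈ 0#
  1≉0 1≈0 = irrefl (sym 1≈0) 0<1

  *-cancelˡ-≈0 : ∀ {x y} → ¬ x ≈ 0# → x * y ≈ 0# → y ≈ 0#
  *-cancelˡ-≈0 {x} {y} x≉0 xy≈0 with inverse x x≉0
  ... | x⁻¹ , xx⁻¹≈1 = begin
    y              ≈⟨ *-identityˡ y ⟨
    1# * y         ≈⟨ *-congʳ (trans (*-comm _ _) xx⁻¹≈1) ⟨
    x⁻¹ * x * y    ≈⟨ *-assoc _ _ _ ⟩
    x⁻¹ * (x * y)  ≈⟨ *-congˡ xy≈0 ⟩
    x⁻¹ * 0#       ≈⟨ zeroʳ x⁻¹ ⟩
    0#             ∎

  sum-zero : ∀ {n} {f : Vector Carrier n} → (∀ j → f j ≈ 0#) → sum f ≈ 0#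
  sum-zero {n} f≈0 = trans (sum-cong-≋ f≈0) (sum-replicate-zero n)

  sum-↑ : ∀ n {m} (f : Vector Carrier (n ℕ.+ m)) →
          sum f ≈ sum (f ∘ (_↑ˡ m)) + sum (f ∘ (n ↑ʳ_))
  sum-↑ zero    f = sym (+-identityˡ _)
  sum-↑ (suc n) f = trans (+-congˡ (sum-↑ n (f ∘ suc))) (sym (+-assoc _ _ _))

  sum-single : ∀ {n} {f : Vector Carrier n} i → (∀ j → ¬ j ≡ i → f j ≈ 0#) → sum f ≈ f i
  sum-single {suc n} {f} i f≈0 = begin
    sum f                                ≈⟨ sum-remove {i = i} f ⟩
    f i + sum (Vector.removeAt f i)      ≈⟨ +-congˡ (sum-zero λ j → f≈0 _ (Fin.punchInᵢ≢i i j)) ⟩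
    f i + 0#                             ≈⟨ +-identityʳ _ ⟩
    f i                                  ∎

  module _ {X : Set} where

    infix 4 _⊆ᵖ_

    _⊆ᵖ_ : Pred (X → Carrier) 0ℓ → Pred (X → Carrier) 0ℓ → Set
    P ⊆ᵖ Q = ∀ {c} → P c → Q c

    basis-transport : ∀ {P Q : Pred (X → Carrier) 0ℓ} {n} → P ⊆ᵖ Q → Q ⊆ᵖ P → Basis P n → Basis Q n
    basis-transport P⊆Q Q⊆P B = record
      { vectors     = vectors
      ; member      = P⊆Q ∘ member
      ; independent = independent
      ; spanning    = λ c → spanning c ∘ Q⊆P
      }
      where open Basis B

    trivial-basis : ∀ {P : Pred (X → Carrier) 0ℓ} → (∀ {c} → P c → c ≋ (λ _ → 0#)) → Basis P 0
    trivial-basis P≈0 = record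
      { vectors     = λ ()
      ; member      = λ ()
      ; independent = λ _ _ ()
      ; spanning    = λ c Pc → (λ ()) , P≈0 Pc
      }

    Multiple : (X → Carrier) → Pred (X → Carrier) 0ℓ
    Multiple u c = ∃ λ r → c ≋ (λ x → r * u x)

    multiple-basis : ∀ {u} → ¬ u ≋ (λ _ → 0#) → Basis (Multiple u) 1
    multiple-basis {u} u≉0 = record
      { vectors     = λ _ → u
      ; member      = λ _ → 1# , λ _ → sym (*-identityˡ _)
      ; independent = λ { a z zero → decidable-stable (a zero ≟ 0#) λ a₀≉0 →
                          u≉0 λ x → *-cancelˡ-≈0 a₀≉0 (trans (sym (+-identityʳ _)) (z x)) }
      ; spanning    = λ { c (r , eq) → (λ _ → r) , λ y → trans (eq y) (sym (+-identityʳ _)) }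
      }

    cut-subspace : ∀ {P : Pred (X → Carrier) 0ℓ} {φ} → IsSubspace P → IsLinear φ →
                   IsSubspace (λ c → P c × φ c ≈ 0#)
    cut-subspace sub lin = record
      { add   = λ { (Pc , φc) (Pd , φd) → add Pc Pd , trans (φ-add _ _) (trans (+-cong φc φd) (+-identityˡ 0#)) }
      ; scale = λ { r (Pc , φc) → scale r Pc , trans (φ-scale _ _) (trans (*-congˡ φc) (zeroʳ r)) }
      }
      where
      open IsSubspace sub
      open IsLinear lin

    -- Each condition either vanishes on the whole basis, which is then kept, or costs exactly one
    -- basis vector. With fewer conditions than basis vectors at least one vector survives, and
    -- independence makes it nonzero.
    nonzero-solution :
      ∀ n {m} {P : Pred (X → Carrier) 0ℓ} → IsSubspace P → Basis P m → n ℕ.< m →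
      (φ : Fin n → (X → Carrier) → Carrier) → (∀ i → IsLinear (φ i)) →
      ∃ λ c → P c × (∀ i → φ i c ≈ 0#) × ¬ c ≋ (λ _ → 0#)
    nonzero-solution zero {suc m} sub B _ φ lin =
      vectors zero , member zero , (λ ()) , λ b₀≈0 → 1≉0 (independent e (e-zero b₀≈0) zero)
      where
      open Basis B
      e : Vector Carrier (suc m)
      e zero    = 1#
      e (suc _) = 0#
      e-zero : vectors zero ≋ (λ _ → 0#) → combination e vectors ≋ (λ _ → 0#)
      e-zero b₀≈0 x = trans
        (+-cong (trans (*-congˡ (b₀≈0 x)) (zeroʳ _)) (sum-zero λ j → zeroˡ (vectors (suc j) x)))
        (+-identityˡ 0#)
    nonzero-solution (suc n) {suc m} {P} sub B n<m φ lin = extend (step (any? λ j → ¬? (φ₀ (vectors j) ≟ 0#)))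
      where
      open Basis B
      φ₀ = φ zero
      solve-rest : ∀ {l} → n ℕ.< l → Basis (λ c → P c × φ₀ c ≈ 0#) l →
                   ∃ λ c → (P c × φ₀ c ≈ 0#) × (∀ i → φ (suc i) c ≈ 0#) × ¬ c ≋ (λ _ → 0#)
      solve-rest n<l C = nonzero-solution n (cut-subspace sub (lin zero)) C n<l (φ ∘ suc) (lin ∘ suc)
      step : Dec (∃ λ j → ¬ φ₀ (vectors j) ≈ 0#) →
             ∃ λ c → (P c × φ₀ c ≈ 0#) × (∀ i → φ (suc i) c ≈ 0#) × ¬ c ≋ (λ _ → 0#)
      step (no none) = solve-rest (ℕ.<-trans (ℕ.n<1+n n) n<m)
        (Cut.trivial sub (lin zero) B λ j → decidable-stable (_ ≟ 0#) λ ne → none (j , ne))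
      step (yes (k , ne)) with inverse _ ne
      ... | p⁻¹ , eq = solve-rest (ℕ.s<s⁻¹ n<m) (Cut.reduced sub (lin zero) B k p⁻¹ eq)
      extend : (∃ λ c → (P c × φ₀ c ≈ 0#) × (∀ i → φ (suc i) c ≈ 0#) × ¬ c ≋ (λ _ → 0#)) →
               ∃ λ c → P c × (∀ i → φ i c ≈ 0#) × ¬ c ≋ (λ _ → 0#)
      extend (c , (Pc , φ₀c≈0) , φc≈0 , c≉0) =
        c , Pc , (λ { zero → φ₀c≈0 ; (suc i) → φc≈0 i }) , c≉0

    module _ {P Q R : Pred (X → Carrier) 0ℓ} (P⊆R : P ⊆ᵖ R) (Q⊆R : Q ⊆ᵖ R)
             (split : ∀ {c} → R c → ∃ λ a → ∃ λ b → P a × Q b × c ≋ (λ x → a x + b x))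
             (π : X → (X → Carrier) → Carrier) (π-linear : ∀ x → IsLinear (π x))
             (π-P : ∀ {c} → P c → ∀ x → π x c ≈ c x)
             (π-Q : ∀ {c} → Q c → ∀ x → π x c ≈ 0#)
             where

      -- `π` is the projection onto `P` along `Q`, given coordinate by coordinate so that each piece
      -- is a linear functional. Applied to a vanishing combination of the joined bases it isolates
      -- the half from `P`; what remains is the half from `Q`.
      direct-sum-basis : ∀ {n m} → Basis P n → Basis Q m → Basis R (n ℕ.+ m)
      direct-sum-basis {n} {m} B C = record
        { vectors     = v
        ; member      = λ j → member′ (splitAt n j)
        ; independent = independent′
        ; spanning    = spanning′
        }
        where
        module B = Basis B
        module C = Basis C
        v = B.vectors Vector.++ C.vectors

        member′ : ∀ s → R (Sum.[ B.vectors , C.vectors ] s)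
        member′ (inj₁ i) = P⊆R (B.member i)
        member′ (inj₂ j) = Q⊆R (C.member j)

        vˡ : ∀ i x → v (i ↑ˡ m) x ≈ B.vectors i x
        vˡ i x = reflexive (≡.cong (λ c → c x) (lookup-++ˡ B.vectors C.vectors i))

        vʳ : ∀ j x → v (n ↑ʳ j) x ≈ C.vectors j x
        vʳ j x = reflexive (≡.cong (λ c → c x) (lookup-++ʳ B.vectors C.vectors j))

        combination-v : ∀ a x → combination a v x ≈
                        combination (a ∘ (_↑ˡ m)) B.vectors x + combination (a ∘ (n ↑ʳ_)) C.vectors x
        combination-v a x = trans (sum-↑ n (λ j → a j * v j x))
          (+-cong (sum-cong-≋ (λ i → *-congˡ (vˡ i x))) (sum-cong-≋ (λ j → *-congˡ (vʳ j x))))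

        π-combination : ∀ a x → π x (combination a v) ≈ combination (a ∘ (_↑ˡ m)) B.vectors x
        π-combination a x = begin
          π x (combination a v)
            ≈⟨ φ-combination (π-linear x) a v ⟩
          ∑[ j < n ℕ.+ m ] (a j * π x (v j))
            ≈⟨ sum-↑ n (λ j → a j * π x (v j)) ⟩
          ∑[ i < n ] (a (i ↑ˡ m) * π x (v (i ↑ˡ m))) + ∑[ j < m ] (a (n ↑ʳ j) * π x (v (n ↑ʳ j)))
            ≈⟨ +-cong
                 (sum-cong-≋ (λ i → *-congˡ (trans (φ-cong (vˡ i)) (π-P (B.member i) x))))
                 (sum-zero (λ j → trans (*-congˡ (trans (φ-cong (vʳ j)) (π-Q (C.member j) x))) (zeroʳ _))) ⟩
          combination (a ∘ (_↑ˡ m)) B.vectors x + 0#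
            ≈⟨ +-identityʳ _ ⟩
          combination (a ∘ (_↑ˡ m)) B.vectors x ∎
          where open IsLinear (π-linear x)

        independent′ : ∀ a → combination a v ≋ (λ _ → 0#) → ∀ j → a j ≈ 0#
        independent′ a av≈0 j = trans (reflexive (≡.cong a (≡.sym (join-splitAt n m j)))) (zero-at (splitAt n j))
          where
          left : combination (a ∘ (_↑ˡ m)) B.vectors ≋ (λ _ → 0#)
          left x = trans (sym (π-combination a x))
                         (trans (IsLinear.φ-cong (π-linear x) av≈0) (φ-zero (π-linear x)))
          right : combination (a ∘ (n ↑ʳ_)) C.vectors ≋ (λ _ → 0#)
          right x = trans (sym (+-identityˡ _))
                   (trans (+-congʳ (sym (left x))) (trans (sym (combination-v a x)) (av≈0 x)))
          zero-at : ∀ s → a (join n m s) ≈ 0#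
          zero-at (inj₁ i) = B.independent _ left i
          zero-at (inj₂ j) = C.independent _ right j

        spanning′ : ∀ c → R c → ∃ λ a → c ≋ combination a v
        spanning′ c Rc with split Rc
        ... | p , q , Pp , Qq , c≋p+q with B.spanning p Pp | C.spanning q Qq
        ... | a , p≋a | b , q≋b = a Vector.++ b , λ x → begin
          c x
            ≈⟨ c≋p+q x ⟩
          p x + q x
            ≈⟨ +-cong (trans (p≋a x) (sum-cong-≋ λ i → *-congʳ (reflexive (≡.sym (lookup-++ˡ a b i)))))
                      (trans (q≋b x) (sum-cong-≋ λ j → *-congʳ (reflexive (≡.sym (lookup-++ʳ a b j))))) ⟩
          combination ((a Vector.++ b) ∘ (_↑ˡ m)) B.vectors x + combination ((a Vector.++ b) ∘ (n ↑ʳ_)) C.vectors x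
            ≈⟨ combination-v (a Vector.++ b) x ⟨
          combination (a Vector.++ b) v x ∎

    module _ {P Q : Pred (X → Carrier) 0ℓ} (Q-sub : IsSubspace Q)
             {ρ : (X → Carrier) → Carrier} (ρ-linear : IsLinear ρ)
             {u : X → Carrier} (Qu : Q u) (ρu≉0 : ¬ ρ u ≈ 0#)
             (resp : ∀ {c d} → c ≋ d → Q c → Q d)
             (P⊆Q : P ⊆ᵖ Q) (P-ρ : ∀ {c} → P c → ρ c ≈ 0#)
             (Q∩ρ⊆P : ∀ {c} → Q c → ρ c ≈ 0# → P c) where
      private
        open IsLinear ρ-linear
        open IsSubspace Q-sub
        ρu⁻¹ : Carrier
        ρu⁻¹ = proj₁ (inverse (ρ u) ρu≉0)
        ρu-inv : ρ u * ρu⁻¹ ≈ 1#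
        ρu-inv = proj₂ (inverse (ρ u) ρu≉0)

      -- `Q` is the line through `u` plus the kernel of `ρ` in `Q`; the projection onto the line
      -- sends `c` to `(ρ c / ρ u) u`.
      hyperplane-basis : ∀ {n} → Basis P n → Basis Q (suc n)
      hyperplane-basis B = direct-sum-basis {P = Multiple u}
        (λ { (r , eq) → resp (sym ∘ eq) (scale r Qu) }) P⊆Q split
        (λ x c → ρ c * (ρu⁻¹ * u x)) π-linear
        (λ { {c} (r , eq) y → begin
          ρ c * (ρu⁻¹ * u y)                     ≈⟨ *-congʳ (φ-cong eq) ⟩
          ρ (λ x → r * u x) * (ρu⁻¹ * u y)       ≈⟨ *-congʳ (φ-scale r u) ⟩
          r * ρ u * (ρu⁻¹ * u y)                 ≈⟨ cancel r y ⟩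
          r * u y                                ≈⟨ eq y ⟨
          c y                                    ∎ })
        (λ Pc y → trans (*-congʳ (P-ρ Pc)) (zeroˡ _))
        (multiple-basis λ u≈0 → ρu≉0 (trans (φ-cong u≈0) (φ-zero ρ-linear))) B
        where
        cancel : ∀ r y → r * ρ u * (ρu⁻¹ * u y) ≈ r * u y
        cancel r y = begin
          r * ρ u * (ρu⁻¹ * u y)   ≈⟨ *-assoc _ _ _ ⟩
          r * (ρ u * (ρu⁻¹ * u y)) ≈⟨ *-congˡ (*-assoc _ _ _) ⟨
          r * (ρ u * ρu⁻¹ * u y)   ≈⟨ *-congˡ (*-congʳ ρu-inv) ⟩
          r * (1# * u y)           ≈⟨ *-congˡ (*-identityˡ _) ⟩
          r * u y                  ∎
        π-linear : ∀ x → IsLinear (λ c → ρ c * (ρu⁻¹ * u x))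
        π-linear x = record
          { φ-cong  = *-congʳ ∘ φ-cong
          ; φ-add   = λ c d → trans (*-congʳ (φ-add c d)) (distribʳ _ _ _)
          ; φ-scale = λ r c → trans (*-congʳ (φ-scale r c)) (*-assoc _ _ _)
          }
        split : ∀ {c} → Q c → ∃ λ a → ∃ λ b → Multiple u a × P b × c ≋ (λ x → a x + b x)
        split {c} Qc =
          (λ x → r * u x) , (λ x → c x + (- r) * u x) , (r , λ _ → refl) ,
          Q∩ρ⊆P (add Qc (scale (- r) Qu)) ρ-zero , λ x → sym (begin
            r * u x + (c x + (- r) * u x)  ≈⟨ +-congˡ (+-comm _ _) ⟩
            r * u x + ((- r) * u x + c x)  ≈⟨ +-assoc _ _ _ ⟨
            r * u x + (- r) * u x + c x    ≈⟨ +-congʳ (distribʳ _ _ _) ⟨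
            (r + - r) * u x + c x          ≈⟨ +-congʳ (trans (*-congʳ (-‿inverseʳ r)) (zeroˡ _)) ⟩
            0# + c x                       ≈⟨ +-identityˡ _ ⟩
            c x                            ∎)
          where
          r = ρ c * ρu⁻¹
          ρ-zero : ρ (λ x → c x + (- r) * u x) ≈ 0#
          ρ-zero = begin
            ρ (λ x → c x + (- r) * u x)  ≈⟨ φ-add _ _ ⟩
            ρ c + ρ (λ x → (- r) * u x)  ≈⟨ +-cong (sym ρc) (φ-scale _ _) ⟩
            r * ρ u + (- r) * ρ u        ≈⟨ distribʳ _ _ _ ⟨
            (r + - r) * ρ u              ≈⟨ trans (*-congʳ (-‿inverseʳ r)) (zeroˡ _) ⟩
            0#                           ∎
            where
            ρc : r * ρ u ≈ ρ c
            ρc = trans (*-assoc _ _ _) (trans (*-congˡ (trans (*-comm _ _) ρu-inv)) (*-identityʳ _))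

  coordinate-basis : ∀ n → Basis {Fin n} (λ _ → Unit) n
  coordinate-basis n = record
    { vectors     = δ
    ; member      = λ _ → tt
    ; independent = λ a z j → trans (sym (combination-δ a j)) (z j)
    ; spanning    = λ c _ → c , λ x → sym (combination-δ c x)
    }
    where
    open Supported {Fin n} Fin._≟_ using (δ; δ-diag; δ-off)
    combination-δ : ∀ a x → combination a δ x ≈ a x
    combination-δ a x = begin
      combination a δ x
        ≈⟨ sum-single x (λ j j≢x → trans (*-congˡ (δ-off j≢x)) (zeroʳ _)) ⟩
      a x * δ x x
        ≈⟨ trans (*-congˡ (δ-diag x)) (*-identityʳ _) ⟩
      a x ∎

  weighted-sum-linear : ∀ {m} (w : Vector Carrier m) → IsLinear (λ c → ∑[ j < m ] (c j * w j))
  weighted-sum-linear {m} w = record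
    { φ-cong  = λ c≋d → sum-cong-≋ {m} (λ j → *-congʳ (c≋d j))
    ; φ-add   = λ c d → trans (sum-cong-≋ {m} (λ j → distribʳ (w j) (c j) (d j)))
                              (∑-distrib-+ (λ j → c j * w j) (λ j → d j * w j))
    ; φ-scale = λ r c → trans (sum-cong-≋ {m} (λ j → *-assoc r (c j) (w j)))
                              (sym (*-distribˡ-sum r (λ j → c j * w j)))
    }

  module _ {X : Set} {P : Pred (X → Carrier) 0ℓ} where

    -- Writing the `m` vectors of the second basis in terms of the first gives `n` linear equations
    -- for `m` unknown coefficients. For n < m they have a nonzero solution, which is a linear
    -- dependence among independent vectors.
    dimension-≮ : ∀ {n m} → Basis P n → Basis P m → ¬ n ℕ.< m
    dimension-≮ {n} {m} B C n<m
      with nonzero-solution n {P = λ _ → Unit} (record { add = λ _ _ → tt ; scale = λ _ _ → tt })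
             (coordinate-basis m) n<m
             (λ i c → ∑[ j < m ] (c j * proj₁ (spanning B (vectors C j) (member C j)) i))
             (λ i → weighted-sum-linear (λ j → proj₁ (spanning B (vectors C j) (member C j)) i))
      where open Basis
    ... | c , _ , Ac≈0 , c≉0 = c≉0 (independent c zero-combination)
      where
      open Basis C
      A : Fin m → Fin n → Carrier
      A j = proj₁ (Basis.spanning B (vectors j) (member j))
      b = Basis.vectors B
      zero-combination : combination c vectors ≋ (λ _ → 0#)
      zero-combination x = begin
        ∑[ j < m ] (c j * vectors j x)
          ≈⟨ sum-cong-≋ (λ j → *-congˡ (proj₂ (Basis.spanning B (vectors j) (member j)) x)) ⟩
        ∑[ j < m ] (c j * ∑[ i < n ] (A j i * b i x))
          ≈⟨ sum-cong-≋ (λ j → trans (*-distribˡ-sum (c j) (λ i → A j i * b i x))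
                                     (sum-cong-≋ (λ i → sym (*-assoc (c j) (A j i) (b i x))))) ⟩
        ∑[ j < m ] ∑[ i < n ] (c j * A j i * b i x)
          ≈⟨ ∑-comm (λ j i → c j * A j i * b i x) ⟩
        ∑[ i < n ] ∑[ j < m ] (c j * A j i * b i x)
          ≈⟨ sum-zero (λ i → trans (sym (*-distribʳ-sum (b i x) (λ j → c j * A j i)))
                                   (trans (*-congʳ (Ac≈0 i)) (zeroˡ _))) ⟩
        0# ∎

    -- This is the only access to the value of `multiplicity`: any other basis of the same
    -- eigenspace has the same size.
    dimension-unique : ∀ {n m} → Basis P n → Basis P m → n ≡ m
    dimension-unique B C = ℕ.≤-antisym (ℕ.≮⇒≥ (dimension-≮ C B)) (ℕ.≮⇒≥ (dimension-≮ B C))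

-- Sizes of finite sets and the facet relation.

∣p∣≡1+∣p-x∣ : ∀ {n} {p : Subset n} {x} → x ∈ p → ∣ p ∣ ≡ suc ∣ p - x ∣
∣p∣≡1+∣p-x∣ {p = inside  ∷ p} here       = ≡.cong (suc ∘ ∣_∣) (≡.sym (p─⊥≡p p))
∣p∣≡1+∣p-x∣ {p = inside  ∷ p} (there x∈) = ≡.cong suc (∣p∣≡1+∣p-x∣ x∈)
∣p∣≡1+∣p-x∣ {p = outside ∷ p} (there x∈) = ∣p∣≡1+∣p-x∣ x∈

∣p∣≡0⇒p≡⊥ : ∀ {n} {p : Subset n} → ∣ p ∣ ≡ 0 → p ≡ ⊥
∣p∣≡0⇒p≡⊥ ∣p∣≡0 = Empty-unique λ (x , x∈p) →
  contradiction (≡.trans (≡.sym ∣p∣≡0) (∣p∣≡1+∣p-x∣ x∈p)) λ ()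

⁅x⁆⊆p : ∀ {n} {p : Subset n} {x} → x ∈ p → ⁅ x ⁆ ⊆ p
⁅x⁆⊆p {x = x} x∈p y∈⁅x⁆ with ≡.refl ← x∈⁅y⁆⇒x≡y x y∈⁅x⁆ = x∈p

x∈p∧∣p∣≡1⇒p≡⁅x⁆ : ∀ {n} {p : Subset n} {x} → x ∈ p → ∣ p ∣ ≡ 1 → p ≡ ⁅ x ⁆
x∈p∧∣p∣≡1⇒p≡⁅x⁆ {p = p} {x} x∈p ∣p∣≡1 = ⊆-antisym p⊆⁅x⁆ (⁅x⁆⊆p x∈p)
  where
  p-x≡⊥ : p - x ≡ ⊥
  p-x≡⊥ = ∣p∣≡0⇒p≡⊥ (ℕ.suc-injective (≡.trans (≡.sym (∣p∣≡1+∣p-x∣ x∈p)) ∣p∣≡1))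
  p⊆⁅x⁆ : p ⊆ ⁅ x ⁆
  p⊆⁅x⁆ {y} y∈p = decidable-stable (y ∈? ⁅ x ⁆) λ y∉ →
    ∉⊥ (≡.subst (y ∈_) p-x≡⊥ (x∈p∧x∉q⇒x∈p─q y∈p y∉))

IsFacet : ∀ {N} → Subset N → Subset N → Set
IsFacet G F = ∃ λ v → v ∈ F × G ≡ F - v

facet-size : ∀ {N} {G F : Subset N} → IsFacet G F → ∣ F ∣ ≡ suc ∣ G ∣
facet-size (v , v∈F , ≡.refl) = ∣p∣≡1+∣p-x∣ v∈F

facet-⊆ : ∀ {N} {G F : Subset N} → IsFacet G F → G ⊆ F
facet-⊆ {F = F} (v , _ , ≡.refl) = p─q⊆p F ⁅ v ⁆

-- Finite sums over subsets and the incidence matrix.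

module Incidence (ℝ : CompleteOrderedField) where

  open CompleteOrderedField ℝ hiding (_-_; zero)
  open LinearAlgebra ℝ
  open Spectrum ℝ
  open Dimension ℝ
  open import Algebra.Properties.Semiring.Exp semiring using (_^_)
  open import Algebra.Properties.Semiring.Sum semiring
    using (sum; sum-syntax; sum-cong-≋; *-distribˡ-sum)
  open import Algebra.Properties.CommutativeSemigroup +-commutativeSemigroup using (interchange)
  open import Relation.Binary.Reasoning.Setoid setoid

  module _ {X : Set} where

    ∑ₗ : List X → (X → Carrier) → Carrier
    ∑ₗ xs f = foldr (λ x s → f x + s) 0# xs

    ∑ₗ-cong : ∀ xs {f g} → (∀ x → f x ≈ g x) → ∑ₗ xs f ≈ ∑ₗ xs g
    ∑ₗ-cong []       f≈g = refl
    ∑ₗ-cong (x ∷ xs) f≈g = +-cong (f≈g x) (∑ₗ-cong xs f≈g)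

    ∑ₗ-+ : ∀ xs f g → ∑ₗ xs (λ x → f x + g x) ≈ ∑ₗ xs f + ∑ₗ xs g
    ∑ₗ-+ []       f g = sym (+-identityˡ 0#)
    ∑ₗ-+ (x ∷ xs) f g = trans (+-congˡ (∑ₗ-+ xs f g)) (interchange _ _ _ _)

    ∑ₗ-* : ∀ xs r f → ∑ₗ xs (λ x → r * f x) ≈ r * ∑ₗ xs f
    ∑ₗ-* []       r f = sym (zeroʳ r)
    ∑ₗ-* (x ∷ xs) r f = trans (+-congˡ (∑ₗ-* xs r f)) (sym (distribˡ _ _ _))

    ∑ₗ-zero : ∀ xs {f} → (∀ x → f x ≈ 0#) → ∑ₗ xs f ≈ 0#
    ∑ₗ-zero []       f≈0 = refl
    ∑ₗ-zero (x ∷ xs) f≈0 = trans (+-cong (f≈0 x) (∑ₗ-zero xs f≈0)) (+-identityˡ 0#)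

    ∑ₗ-++ : ∀ xs ys f → ∑ₗ (xs List.++ ys) f ≈ ∑ₗ xs f + ∑ₗ ys f
    ∑ₗ-++ []       ys f = sym (+-identityˡ _)
    ∑ₗ-++ (x ∷ xs) ys f = trans (+-congˡ (∑ₗ-++ xs ys f)) (sym (+-assoc _ _ _))

    ∑ₗ-sum : ∀ xs {n} (f : X → Fin n → Carrier) →
             ∑ₗ xs (λ x → ∑[ i < n ] f x i) ≈ ∑[ i < n ] ∑ₗ xs (λ x → f x i)
    ∑ₗ-sum xs {zero}  f = ∑ₗ-zero xs λ _ → refl
    ∑ₗ-sum xs {suc n} f = trans (∑ₗ-+ xs _ _) (+-congˡ (∑ₗ-sum xs (λ x → f x ∘ suc)))

  ∑ₗ-map : ∀ {X Y : Set} (h : X → Y) xs f → ∑ₗ (List.map h xs) f ≈ ∑ₗ xs (f ∘ h)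
  ∑ₗ-map h []       f = refl
  ∑ₗ-map h (x ∷ xs) f = +-congˡ (∑ₗ-map h xs f)

  ∑ₗ-swap : ∀ {X Y : Set} xs ys (f : X → Y → Carrier) →
            ∑ₗ xs (λ x → ∑ₗ ys (f x)) ≈ ∑ₗ ys (λ y → ∑ₗ xs (λ x → f x y))
  ∑ₗ-swap []       ys f = sym (∑ₗ-zero ys λ _ → refl)
  ∑ₗ-swap (x ∷ xs) ys f = trans (+-congˡ (∑ₗ-swap xs ys f)) (sym (∑ₗ-+ ys _ _))

  module _ {N : ℕ} where

    ∑ˢ-cong : ∀ {f g : Subset N → Carrier} → (∀ F → f F ≈ g F) → ∑ˢ f ≈ ∑ˢ g
    ∑ˢ-cong = ∑ₗ-cong (allSubsets N)

    ∑ˢ-+ : ∀ (f g : Subset N → Carrier) → ∑ˢ (λ F → f F + g F) ≈ ∑ˢ f + ∑ˢ g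
    ∑ˢ-+ = ∑ₗ-+ (allSubsets N)

    ∑ˢ-* : ∀ r (f : Subset N → Carrier) → ∑ˢ (λ F → r * f F) ≈ r * ∑ˢ f
    ∑ˢ-* = ∑ₗ-* (allSubsets N)

    ∑ˢ-zero : ∀ {f : Subset N → Carrier} → (∀ F → f F ≈ 0#) → ∑ˢ f ≈ 0#
    ∑ˢ-zero = ∑ₗ-zero (allSubsets N)

    ∑ˢ-swap : ∀ (f : Subset N → Subset N → Carrier) →
              ∑ˢ (λ F → ∑ˢ (f F)) ≈ ∑ˢ (λ G → ∑ˢ (λ F → f F G))
    ∑ˢ-swap = ∑ₗ-swap (allSubsets N) (allSubsets N)

    ∑ˢ-linear : ∀ (w : Subset N → Carrier) → IsLinear (λ c → ∑ˢ (λ G → w G * c G))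
    ∑ˢ-linear w = record
      { φ-cong  = λ c≋d → ∑ˢ-cong (λ G → *-congˡ (c≋d G))
      ; φ-add   = λ c d → trans (∑ˢ-cong (λ G → distribˡ (w G) (c G) (d G)))
                                (∑ˢ-+ (λ G → w G * c G) (λ G → w G * d G))
      ; φ-scale = λ r c → trans (∑ˢ-cong (λ G → x∙yz≈y∙xz *-commutativeSemigroup (w G) r (c G)))
                                (∑ˢ-* r (λ G → w G * c G))
      }

  ∑ˢ-split : ∀ {N} (f : Subset (suc N) → Carrier) →
             ∑ˢ f ≈ ∑ˢ (f ∘ (outside ∷_)) + ∑ˢ (f ∘ (inside ∷_))
  ∑ˢ-split {N} f = trans
    (∑ₗ-++ (List.map (outside ∷_) (allSubsets N)) (List.map (inside ∷_) (allSubsets N)) f)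
    (+-cong (∑ₗ-map (outside ∷_) (allSubsets N) f) (∑ₗ-map (inside ∷_) (allSubsets N) f))

  ∑ˢ-single : ∀ {N} {f : Subset N → Carrier} F → (∀ G → ¬ G ≡ F → f G ≈ 0#) → ∑ˢ f ≈ f F
  ∑ˢ-single []                f≈0 = +-identityʳ _
  ∑ˢ-single {suc N} {f} (outside ∷ F) f≈0 = trans (∑ˢ-split f) (trans
    (+-cong (∑ˢ-single {N} F (λ G G≢F → f≈0 (_ ∷ G) λ { ≡.refl → G≢F ≡.refl })) (∑ˢ-zero {N} (λ G → f≈0 (_ ∷ G) λ ())))
    (+-identityʳ _))
  ∑ˢ-single {suc N} {f} (inside  ∷ F) f≈0 = trans (∑ˢ-split f) (trans
    (+-cong (∑ˢ-zero {N} (λ G → f≈0 (_ ∷ G) λ ())) (∑ˢ-single {N} F (λ G G≢F → f≈0 (_ ∷ G) λ { ≡.refl → G≢F ≡.refl })))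
    (+-identityˡ _))

  gate : ∀ {A : Set} → Dec A → Carrier → Carrier
  gate A? x = if does A? then x else 0#

  module _ {A : Set} where

    gate-yes : ∀ (A? : Dec A) {x} → A → gate A? x ≈ x
    gate-yes (yes _) a = refl
    gate-yes (no ¬a) a = contradiction a ¬a

    gate-no : ∀ (A? : Dec A) {x} → ¬ A → gate A? x ≈ 0#
    gate-no (yes a) ¬a = contradiction a ¬a
    gate-no (no _)  ¬a = refl

    gate-zero : ∀ (A? : Dec A) {x} → x ≈ 0# → gate A? x ≈ 0#
    gate-zero (yes a) x≈0 = x≈0
    gate-zero (no _)  x≈0 = refl

    gate-≉0 : ∀ (A? : Dec A) {x} → ¬ gate A? x ≈ 0# → A × ¬ x ≈ 0#
    gate-≉0 (yes a) x≉0 = a , x≉0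
    gate-≉0 (no _)  0≉0 = contradiction refl 0≉0

    gate-* : ∀ (A? : Dec A) r x → gate A? (r * x) ≈ r * gate A? x
    gate-* (yes _) r x = refl
    gate-* (no _)  r x = sym (zeroʳ r)

  -- Entries of boundary matrices are gated incidence numbers. Two gates need to agree only where
  -- the incidence is nonzero, and there the facet relation, hence a relation between the sizes, is
  -- available.
  gate-cong : ∀ {A B : Set} (A? : Dec A) (B? : Dec B) {x} →
              (¬ x ≈ 0# → A → B) → (¬ x ≈ 0# → B → A) → gate A? x ≈ gate B? x
  gate-cong A? B? {x} A⇒B B⇒A with x ≟ 0#
  ... | yes x≈0 = trans (gate-zero A? x≈0) (sym (gate-zero B? x≈0))
  gate-cong (yes a) B? A⇒B B⇒A | no x≉0 = sym (gate-yes B? (A⇒B x≉0 a))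
  gate-cong (no ¬a) B? A⇒B B⇒A | no x≉0 = sym (gate-no B? (¬a ∘ B⇒A x≉0))

  -- The counterpart of `gate-cong` for products: a nonzero second factor carries the information
  -- that makes the first factors comparable.
  *-cong-≉0 : ∀ {x x′ y y′} → y ≈ y′ → (¬ y′ ≈ 0# → x ≈ x′) → x * y ≈ x′ * y′
  *-cong-≉0 {x} {x′} {y} {y′} y≈y′ x≈x′ with y′ ≟ 0#
  ... | no y′≉0  = *-cong (x≈x′ y′≉0) y≈y′
  ... | yes y′≈0 = trans (trans (*-congˡ (trans y≈y′ y′≈0)) (zeroʳ x))
                         (sym (trans (*-congˡ y′≈0) (zeroʳ x′)))

  ≈0-by : ∀ {A : Set} {x} → (¬ x ≈ 0# → A) → ¬ A → x ≈ 0#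
  ≈0-by {x = x} x≉0⇒A ¬A = decidable-stable (x ≟ 0#) (¬A ∘ x≉0⇒A)

  *-≈0ʳ : ∀ {x y} → y ≈ 0# → x * y ≈ 0#
  *-≈0ʳ y≈0 = trans (*-congˡ y≈0) (zeroʳ _)

  *-≈0ˡ : ∀ {x y} → x ≈ 0# → x * y ≈ 0#
  *-≈0ˡ x≈0 = trans (*-congʳ x≈0) (zeroˡ _)

  -- The value of 1 - 1 + 1 - ... with `n` terms, in Horner form: 0 for even `n`, 1 for odd `n`.
  alternating : ℕ → Carrier
  alternating zero    = 0#
  alternating (suc n) = 1# + - 1# * alternating n

  -- The positions of the elements of `F` are 0, 1, ..., |F| - 1. An element at the head contributes
  -- 1 and raises every later position by one, which is the factor -1.
  alternating-sum : ∀ {N} (F : Subset N) →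
    ∑[ v < N ] gate (v ∈? F) ((- 1#) ^ position F v) ≈ alternating ∣ F ∣
  alternating-sum []            = refl
  alternating-sum (outside ∷ F) = trans (+-identityˡ _) (alternating-sum F)
  alternating-sum {suc N} (inside  ∷ F) = +-congˡ (begin
    ∑[ v < N ] gate (v ∈? F) (- 1# * (- 1#) ^ position F v)
      ≈⟨ sum-cong-≋ {N} (λ v → gate-* (v ∈? F) (- 1#) _) ⟩
    ∑[ v < N ] (- 1# * gate (v ∈? F) ((- 1#) ^ position F v))
      ≈⟨ *-distribˡ-sum (- 1#) (λ v → gate (v ∈? F) ((- 1#) ^ position F v)) ⟨
    - 1# * ∑[ v < N ] gate (v ∈? F) ((- 1#) ^ position F v)
      ≈⟨ *-congˡ (alternating-sum F) ⟩
    - 1# * alternating ∣ F ∣ ∎)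

  alternating-1 : alternating 1 ≈ 1#
  alternating-1 = trans (+-congˡ (zeroʳ _)) (+-identityʳ 1#)

  alternating-2 : alternating 2 ≈ 0#
  alternating-2 = trans (+-congˡ (trans (*-congˡ alternating-1) (*-identityʳ _))) (-‿inverseʳ 1#)

  module _ {N : ℕ} where

    incidence-≉0 : ∀ (G F : Subset N) → ¬ incidence G F ≈ 0# → IsFacet G F
    incidence-≉0 G F ≉0 with any? (λ v → v ∈? F ×-dec G ≟ˢ F - v)
    ... | yes facet  = facet
    ... | no ¬facet = contradiction
      (sum-zero λ v → gate-no (v ∈? F ×-dec G ≟ˢ F - v) (λ f → ¬facet (v , f))) ≉0

    incidence-⊥ : ∀ {F : Subset N} → ∣ F ∣ ≡ 1 → incidence ⊥ F ≈ 1#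
    incidence-⊥ {F} ∣F∣≡1 = begin
      incidence ⊥ F
        ≈⟨ sum-cong-≋ {N} (λ v → gate-cong (v ∈? F ×-dec ⊥ ≟ˢ F - v) (v ∈? F)
             (λ _ → proj₁)
             (λ _ v∈F → v∈F , ≡.sym (∣p∣≡0⇒p≡⊥ (ℕ.suc-injective (≡.trans (≡.sym (∣p∣≡1+∣p-x∣ v∈F)) ∣F∣≡1))))) ⟩
      ∑[ v < N ] gate (v ∈? F) ((- 1#) ^ position F v)
        ≈⟨ alternating-sum F ⟩
      alternating ∣ F ∣
        ≡⟨ ≡.cong alternating ∣F∣≡1 ⟩
      alternating 1
        ≈⟨ alternating-1 ⟩
      1# ∎

    -- Column sums of the incidence matrix. Since ∂₀ sends every vertex to the empty face with
    -- coefficient 1, their vanishing for |F| = 2 is ∂₀ ∂₁ = 0.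
    ∑-incidence : ∀ (F : Subset N) → ∑ˢ (λ G → incidence G F) ≈ alternating ∣ F ∣
    ∑-incidence F = begin
      ∑ˢ (λ G → incidence G F)
        ≈⟨ ∑ₗ-sum (allSubsets N) (λ G v → gate (v ∈? F ×-dec G ≟ˢ F - v) ((- 1#) ^ position F v)) ⟩
      ∑[ v < N ] ∑ˢ (λ G → gate (v ∈? F ×-dec G ≟ˢ F - v) ((- 1#) ^ position F v))
        ≈⟨ sum-cong-≋ {N} (λ v → trans
             (∑ˢ-single (F - v) (λ G G≢ → gate-no (v ∈? F ×-dec G ≟ˢ F - v) (G≢ ∘ proj₂)))
             (gate-cong (v ∈? F ×-dec F - v ≟ˢ F - v) (v ∈? F) (λ _ → proj₁) (λ _ v∈F → v∈F , ≡.refl))) ⟩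
      ∑[ v < N ] gate (v ∈? F) ((- 1#) ^ position F v)
        ≈⟨ alternating-sum F ⟩
      alternating ∣ F ∣ ∎

-- Laplacians of set families without a dimension index.

k⊖1+1≡+k : ∀ k → k ⊖ 1 ℤ.+ ℤ.1ℤ ≡ + k
k⊖1+1≡+k zero    = ≡.refl
k⊖1+1≡+k (suc k) = ≡.cong +_ (ℕ.+-comm k 1)

⊖1-injective : ∀ m n → m ⊖ 1 ≡ n ⊖ 1 → m ≡ n
⊖1-injective zero    zero    _  = ≡.refl
⊖1-injective (suc m) (suc n) eq = ≡.cong suc (ℤ.+-injective eq)

module _ {N : ℕ} {V : Subset N} where

  RelativeFace : Pair V → Pred (Subset N) 0ℓ
  RelativeFace (Δ , Δ′) F = Face Δ F × ¬ Face Δ′ F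

  relativeFace? : (P : Pair V) → Decidable (RelativeFace P)
  relativeFace? (Δ , Δ′) F = Face? Δ F ×-dec ¬? (Face? Δ′ F)

module Laplacians (ℝ : CompleteOrderedField) where

  open CompleteOrderedField ℝ hiding (_-_; zero)
  open LinearAlgebra ℝ
  open Spectrum ℝ
  open Dimension ℝ
  open Incidence ℝ
  open import Relation.Binary.Reasoning.Setoid setoid

  module _ {N : ℕ} where

    ·-cong-support : ∀ (A B : Matrix {N}) {c : Subset N → Carrier} F →
                     (∀ G → ¬ c G ≈ 0# → A F G ≈ B F G) → (A · c) F ≈ (B · c) F
    ·-cong-support A B F A≈B = ∑ˢ-cong {N} λ G → *-cong-≉0 refl (A≈B G)

    ·-zero : ∀ (A : Matrix {N}) {c : Subset N → Carrier} F →
             (∀ G → ¬ c G ≈ 0# → A F G ≈ 0#) → (A · c) F ≈ 0#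
    ·-zero A {c} F A≈0 = ∑ˢ-zero {N} λ G →
      trans (*-cong-≉0 {x′ = 0#} refl (A≈0 G)) (zeroˡ (c G))

    ·-linear : ∀ (A : Matrix {N}) F → IsLinear (λ c → (A · c) F)
    ·-linear A F = ∑ˢ-linear (A F)

    module _ {S : Pred (Subset N) 0ℓ} (S? : Decidable S) where

      -- `incidence` vanishes unless `G` is a facet of `F`, so this single matrix holds the boundary
      -- operators of all dimensions at once. The grading moves into `Supported`, and the integer
      -- arithmetic of dimensions stays confined to `eigenvector-basis`.
      boundary : Matrix {N}
      boundary G F = gate (S? G ×-dec S? F) (incidence G F)

      laplacian : Matrix {N}
      laplacian F G = (boundary ⊗ boundary ᵀ) F G + (boundary ᵀ ⊗ boundary) F G

      Supported : ℕ → Pred (Subset N → Carrier) 0ℓ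
      Supported k c = ∀ F → ¬ (S F × ∣ F ∣ ≡ k) → c F ≈ 0#

      Eigenvector : ℕ → Carrier → Pred (Subset N → Carrier) 0ℓ
      Eigenvector k l c = Supported k c × (∀ F → (laplacian · c) F ≈ l * c F)

      supported : ∀ {k c} → Supported k c → ∀ {F} → ¬ c F ≈ 0# → S F × ∣ F ∣ ≡ k
      supported {k} supp {F} cF≉0 =
        decidable-stable (S? F ×-dec (∣ F ∣ ℕ.≟ k)) (cF≉0 ∘ supp F)

      boundary-≉0 : ∀ {G F} → ¬ boundary G F ≈ 0# → (S G × S F) × IsFacet G F
      boundary-≉0 {G} {F} ≉0 with gate-≉0 (S? G ×-dec S? F) ≉0
      ... | SGF , inc≉0 = SGF , incidence-≉0 G F inc≉0

      laplacian-sym : ∀ F G → laplacian F G ≈ laplacian G F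
      laplacian-sym F G = +-cong (∑ˢ-cong {N} λ H → *-comm _ _) (∑ˢ-cong {N} λ H → *-comm _ _)

      laplacian-outside : ∀ {F} → ¬ S F → ∀ G → laplacian F G ≈ 0#
      laplacian-outside ¬SF G = trans
        (+-cong (∑ˢ-zero {N} λ H → *-≈0ˡ (≈0-by (proj₁ ∘ proj₁ ∘ boundary-≉0) ¬SF))
                (∑ˢ-zero {N} λ H → *-≈0ˡ (≈0-by (proj₂ ∘ proj₁ ∘ boundary-≉0) ¬SF)))
        (+-identityˡ 0#)

      eigenvector-resp : ∀ {k l c d} → c ≋ d → Eigenvector k l c → Eigenvector k l d
      eigenvector-resp c≋d (supp , eig) =
        (λ F ¬SF → trans (sym (c≋d F)) (supp F ¬SF)) ,
        (λ F → trans (IsLinear.φ-cong (·-linear laplacian F) (sym ∘ c≋d)) (trans (eig F) (*-congˡ (c≋d F))))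

      eigenvector-subspace : ∀ {k l} → IsSubspace (Eigenvector k l)
      eigenvector-subspace {l = l} = record
        { add   = λ { (sc , ec) (sd , ed) →
            (λ F ¬SF → trans (+-cong (sc F ¬SF) (sd F ¬SF)) (+-identityˡ 0#)) ,
            (λ F → trans (IsLinear.φ-add (·-linear laplacian F) _ _)
                         (trans (+-cong (ec F) (ed F)) (sym (distribˡ _ _ _)))) }
        ; scale = λ { r (sc , ec) →
            (λ F ¬SF → *-≈0ʳ (sc F ¬SF)) ,
            (λ F → trans (IsLinear.φ-scale (·-linear laplacian F) r _)
                         (trans (*-congˡ (ec F)) (x∙yz≈y∙xz *-commutativeSemigroup _ _ _))) }
        }

    boundary-cong : ∀ {S T : Pred (Subset N) 0ℓ} (S? : Decidable S) (T? : Decidable T) {G F} →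
                    (IsFacet G F → S G × S F → T G × T F) →
                    (IsFacet G F → T G × T F → S G × S F) →
                    boundary S? G F ≈ boundary T? G F
    boundary-cong S? T? {G} {F} S⇒T T⇒S =
      gate-cong (S? G ×-dec S? F) (T? G ×-dec T? F) (S⇒T ∘ incidence-≉0 G F) (T⇒S ∘ incidence-≉0 G F)

  module _ {N : ℕ} {V : Subset N} (P : Pair V) (k : ℕ) {S : Pred (Subset N) 0ℓ} (S? : Decidable S)
           (to   : ∀ F → k ℕ.≤ suc ∣ F ∣ → RelativeFace P F → S F)
           (from : ∀ F → k ℕ.≤ suc ∣ F ∣ → S F → RelativeFace P F) where
    private
      i = k ⊖ 1

      face⇒ : ∀ {F} → IsFace P i F → S F × ∣ F ∣ ≡ k
      face⇒ {F} (f , f′ , d) with ≡.refl ← ⊖1-injective ∣ F ∣ k d = to F (ℕ.n≤1+n _) (f , f′) , ≡.refl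

      face⇐ : ∀ {F} → S F × ∣ F ∣ ≡ k → IsFace P i F
      face⇐ {F} (s , ≡.refl) with from F (ℕ.n≤1+n _) s
      ... | f , f′ = f , f′ , ≡.refl

      ∂-up : ∀ {F H} → ∣ H ∣ ≡ suc k → ∂ P (i ℤ.+ ℤ.1ℤ) F H ≈ boundary S? F H
      ∂-up {F} {H} ∣H∣≡1+k = gate-cong
        (isFace? P (i ℤ.+ ℤ.1ℤ ℤ.- ℤ.1ℤ) F ×-dec isFace? P (i ℤ.+ ℤ.1ℤ) H) (S? F ×-dec S? H)
        (λ { inc ((f , f′ , _) , (h , h′ , _)) → to F (k≤F inc) (f , f′) , to H k≤H (h , h′) })
        (λ { inc (sF , sH) → let (f , f′) = from F (k≤F inc) sF ; (h , h′) = from H k≤H sH in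
             (f , f′ , dimF inc) , (h , h′ , dimH) })
        where
        ∣F∣≡k : ¬ incidence F H ≈ 0# → ∣ F ∣ ≡ k
        ∣F∣≡k inc = ℕ.suc-injective (≡.trans (≡.sym (facet-size (incidence-≉0 F H inc))) ∣H∣≡1+k)
        k≤F : ¬ incidence F H ≈ 0# → k ℕ.≤ suc ∣ F ∣
        k≤F inc = ℕ.≤-trans (ℕ.≤-reflexive (≡.sym (∣F∣≡k inc))) (ℕ.n≤1+n _)
        k≤H : k ℕ.≤ suc ∣ H ∣
        k≤H = ℕ.≤-trans (ℕ.n≤1+n k) (ℕ.≤-trans (ℕ.≤-reflexive (≡.sym ∣H∣≡1+k)) (ℕ.n≤1+n _))
        dimH : dim H ≡ i ℤ.+ ℤ.1ℤ
        dimH = ≡.trans (≡.cong (_⊖ 1) ∣H∣≡1+k) (≡.sym (k⊖1+1≡+k k))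
        dimF : ¬ incidence F H ≈ 0# → dim F ≡ i ℤ.+ ℤ.1ℤ ℤ.- ℤ.1ℤ
        dimF inc = ≡.trans (≡.cong (_⊖ 1) (∣F∣≡k inc)) (≡.cong (ℤ._- ℤ.1ℤ) (≡.sym (k⊖1+1≡+k k)))

      ∂-down : ∀ {H F} → ∣ F ∣ ≡ k → ∂ P i H F ≈ boundary S? H F
      ∂-down {H} {F} ∣F∣≡k = gate-cong
        (isFace? P (i ℤ.- ℤ.1ℤ) H ×-dec isFace? P i F) (S? H ×-dec S? F)
        (λ { inc ((h , h′ , _) , (f , f′ , _)) → to H (k≤H inc) (h , h′) , to F k≤F (f , f′) })
        (λ { inc (sH , sF) → let (h , h′) = from H (k≤H inc) sH ; (f , f′) = from F k≤F sF in
             (h , h′ , dimH inc) , (f , f′ , ≡.cong (_⊖ 1) ∣F∣≡k) })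
        where
        ∣H∣+1≡k : ¬ incidence H F ≈ 0# → suc ∣ H ∣ ≡ k
        ∣H∣+1≡k inc = ≡.trans (≡.sym (facet-size (incidence-≉0 H F inc))) ∣F∣≡k
        k≤H : ¬ incidence H F ≈ 0# → k ℕ.≤ suc ∣ H ∣
        k≤H inc = ℕ.≤-reflexive (≡.sym (∣H∣+1≡k inc))
        k≤F : k ℕ.≤ suc ∣ F ∣
        k≤F = ℕ.≤-trans (ℕ.≤-reflexive (≡.sym ∣F∣≡k)) (ℕ.n≤1+n _)
        dimH : ¬ incidence H F ≈ 0# → dim H ≡ i ℤ.- ℤ.1ℤ
        dimH inc = ≡.cong (λ k → k ⊖ 1 ℤ.- ℤ.1ℤ) (∣H∣+1≡k inc)

      ∂-up-wrong-size : ∀ {G H} → ¬ ∣ H ∣ ≡ suc k → ∣ G ∣ ≡ k → ∂ P (i ℤ.+ ℤ.1ℤ) G H ≈ 0#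
      ∂-up-wrong-size {G} {H} ∣H∣≢ ∣G∣≡k = gate-zero
        (isFace? P (i ℤ.+ ℤ.1ℤ ℤ.- ℤ.1ℤ) G ×-dec isFace? P (i ℤ.+ ℤ.1ℤ) H)
        (≈0-by (incidence-≉0 G H) λ f → ∣H∣≢ (≡.trans (facet-size f) (≡.cong suc ∣G∣≡k)))

      -- Only columns of size `k` act on the chains in question, but the eigenvalue equation is
      -- demanded in every row `F`. In each term the factor involving `G` fixes the size of `H`.
      -- Then either the factors involving `F` agree or both products vanish.
      laplacian-agree : ∀ F {G} → ∣ G ∣ ≡ k → Laplacian P i F G ≈ laplacian S? F G
      laplacian-agree F {G} ∣G∣≡k = +-cong
        (∑ˢ-cong {N} up)
        (∑ˢ-cong {N} λ H → *-cong-≉0 (∂-down ∣G∣≡k) (λ HG≉0 → down H (proj₂ (boundary-≉0 S? HG≉0))))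
        where
        up : ∀ H → ∂ P (i ℤ.+ ℤ.1ℤ) F H * ∂ P (i ℤ.+ ℤ.1ℤ) G H ≈ boundary S? F H * boundary S? G H
        -- For other sizes of `H` the factors in row `F` may differ; the factors in row `G` are zero
        -- on both sides.
        up H with ∣ H ∣ ℕ.≟ suc k
        ... | yes ∣H∣≡1+k = *-cong (∂-up ∣H∣≡1+k) (∂-up ∣H∣≡1+k)
        ... | no  ∣H∣≢1+k = trans (*-≈0ʳ (∂-up-wrong-size ∣H∣≢1+k ∣G∣≡k))
          (sym (*-≈0ʳ (≈0-by (proj₂ ∘ boundary-≉0 S?) λ f → ∣H∣≢1+k (≡.trans (facet-size f) (≡.cong suc ∣G∣≡k)))))
        down : ∀ H → IsFacet H G → ∂ P i H F ≈ boundary S? H F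
        down H HG with ∣ F ∣ ℕ.≟ k
        ... | yes ∣F∣≡k = ∂-down ∣F∣≡k
        ... | no  ∣F∣≢k = trans
          (gate-zero (isFace? P (i ℤ.- ℤ.1ℤ) H ×-dec isFace? P i F) (≈0-by (incidence-≉0 H F) wrong))
          (sym (≈0-by (proj₂ ∘ boundary-≉0 S?) wrong))
          where
          wrong : ¬ IsFacet H F
          wrong HF = ∣F∣≢k (≡.trans (facet-size HF) (≡.trans (≡.sym (facet-size HG)) ∣G∣≡k))

      action-agree : ∀ {c} → Supported S? k c → ∀ F → (Laplacian P i · c) F ≈ (laplacian S? · c) F
      action-agree supp F = ·-cong-support (Laplacian P i) (laplacian S?) F
        λ G cG≉0 → laplacian-agree F (proj₂ (supported S? supp cG≉0))

    -- The Laplacian on sets of size `k` sees only faces of sizes k - 1, k and k + 1. So the family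
    -- `S` has to agree with `P` only on sets of size at least k - 1, which is the bound in `to` and
    -- `from`; this freedom lets the empty face be dropped when k is at least 2.
    eigenvector-basis : ∀ l → Basis (Eigenvector S? k l) (multiplicity P i l)
    eigenvector-basis l = basis-transport
      (λ { (chain , eig) → let supp = λ F ¬SF → chain F (¬SF ∘ face⇒) in
           supp , λ F → trans (sym (action-agree supp F)) (eig F) })
      (λ { (supp , eig) → (λ F ¬f → supp F (¬f ∘ face⇐)) ,
           λ F → trans (action-agree supp F) (eig F) })
      (proj₂ (eigenbasis P i l))

  module _ {N : ℕ} {V : Subset N} (P : Pair V) (k : ℕ) (l : Carrier) where

    relative-basis : Basis (Eigenvector (relativeFace? P) k l) (multiplicity P (k ⊖ 1) l)
    relative-basis = eigenvector-basis P k (relativeFace? P) (λ _ _ → id) (λ _ _ → id) l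

    multiplicity-cong : ∀ {W} (Q : Pair W) →
      (∀ F → k ℕ.≤ suc ∣ F ∣ → RelativeFace P F → RelativeFace Q F) →
      (∀ F → k ℕ.≤ suc ∣ F ∣ → RelativeFace Q F → RelativeFace P F) →
      multiplicity P (k ⊖ 1) l ≡ multiplicity Q (k ⊖ 1) l
    multiplicity-cong Q to from = dimension-unique
      relative-basis (eigenvector-basis Q k (relativeFace? P) from to l)

    multiplicity-unsupported : (∀ F → ∣ F ∣ ≡ k → ¬ RelativeFace P F) → multiplicity P (k ⊖ 1) l ≡ 0
    multiplicity-unsupported none = dimension-unique relative-basis
      (trivial-basis λ { (supp , _) F → supp F λ { (f , ∣F∣≡k) → none F ∣F∣≡k f } })

-- Additivity of multiplicities over disjoint families.

module _ {N : ℕ} where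

  ⊆-disjoint : ∀ {V W G : Subset N} → Empty (V ∩ W) → G ⊆ V → G ⊆ W → G ≡ ⊥
  ⊆-disjoint V∩W≡∅ G⊆V G⊆W = Empty-unique λ (x , x∈G) → V∩W≡∅ (x , x∈p∩q⁺ (G⊆V x∈G , G⊆W x∈G))

module Additivity (ℝ : CompleteOrderedField) where

  open CompleteOrderedField ℝ hiding (_-_; zero)
  open LinearAlgebra ℝ
  open Spectrum ℝ
  open Dimension ℝ
  open Incidence ℝ
  open Laplacians ℝ
  open import Relation.Binary.Reasoning.Setoid setoid

  -- S is a union of connected components of U, where two sets are joined
  -- if one is a facet of the other.
  record IsComponent {N : ℕ} (S U : Pred (Subset N) 0ℓ) : Set where
    field
      sub  : ∀ {F} → S F → U F
      up   : ∀ {G F} → IsFacet G F → S G → U F → S F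
      down : ∀ {G F} → IsFacet G F → S F → U G → S G

  module _ {N : ℕ} {S U : Pred (Subset N) 0ℓ} (S? : Decidable S) (U? : Decidable U)
           (component : IsComponent S U) where
    open IsComponent component

    -- A term of the Laplacian is a path `G`, `H`, `F` of two facet steps. Starting in `S`, the
    -- component property keeps first `H` and then `F` in `S`.
    laplacian-component : ∀ F {G} → S G → laplacian U? F G ≈ laplacian S? F G
    laplacian-component F {G} sG = +-cong
      (∑ˢ-cong {N} λ H → *-cong-≉0
        (boundary-cong U? S? (λ { GH (_ , uH) → sG , up GH sG uH }) (λ { _ (_ , sH) → sub sG , sub sH }))
        (λ GH≉0 → let sH = proj₂ (proj₁ (boundary-≉0 S? GH≉0)) in
          boundary-cong U? S? (λ { FH (uF , _) → down FH sH uF , sH }) (λ { _ (sF , _) → sub sF , sub sH })))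
      (∑ˢ-cong {N} λ H → *-cong-≉0
        (boundary-cong U? S? (λ { HG (uH , _) → down HG sG uH , sG }) (λ { _ (sH , _) → sub sH , sub sG }))
        (λ HG≉0 → let sH = proj₁ (proj₁ (boundary-≉0 S? HG≉0)) in
          boundary-cong U? S? (λ { HF (_ , uF) → sH , up HF sH uF }) (λ { _ (_ , sF) → sub sH , sub sF })))

    action-component : ∀ {c} → (∀ G → ¬ c G ≈ 0# → S G) → ∀ F → (laplacian U? · c) F ≈ (laplacian S? · c) F
    action-component c⊆S F = ·-cong-support (laplacian U?) (laplacian S?) F
      λ G cG≉0 → laplacian-component F (c⊆S G cG≉0)

    extend-eigenvector : ∀ {k l c} → Eigenvector S? k l c → Eigenvector U? k l c
    extend-eigenvector (supp , eig) =
      (λ F ¬UF → supp F (λ (sF , ∣F∣≡k) → ¬UF (sub sF , ∣F∣≡k))) ,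
      (λ F → trans (action-component (λ G cG≉0 → proj₁ (supported S? supp cG≉0)) F) (eig F))

  restrict : ∀ {N} {S : Pred (Subset N) 0ℓ} → Decidable S → (Subset N → Carrier) → Subset N → Carrier
  restrict S? c F = gate (S? F) (c F)

  module _ {N : ℕ} {S T U : Pred (Subset N) 0ℓ} (S? : Decidable S) (T? : Decidable T) (U? : Decidable U)
           (S-component : IsComponent S U) (T-component : IsComponent T U)
           (disjoint : ∀ {F} → S F → ¬ T F) (split : ∀ {F} → U F → S F ⊎ T F) where

    restrict-sum : ∀ {k c} → Supported U? k c → c ≋ (λ F → restrict S? c F + restrict T? c F)
    restrict-sum {c = c} supp F with S? F | T? F
    ... | yes sF | yes tF = contradiction tF (disjoint sF)
    ... | yes _  | no _   = sym (+-identityʳ _)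
    ... | no _   | yes _  = sym (+-identityˡ _)
    ... | no ¬sF | no ¬tF = trans (supp F λ (uF , _) → neither (split uF)) (sym (+-identityˡ _))
      where
      neither : ¬ (S F ⊎ T F)
      neither (inj₁ sF) = ¬sF sF
      neither (inj₂ tF) = ¬tF tF

    -- The Laplacian of `U` sends `c` to the `S` block applied to one restriction plus the `T` block
    -- applied to the other. In a row of `S` the `T` block is zero, so the equation for `c` becomes
    -- the one for its restriction; in other rows both sides vanish.
    restrict-eigenvector : ∀ {k l c} → Eigenvector U? k l c → Eigenvector S? k l (restrict S? c)
    restrict-eigenvector {k} {l} {c} (supp , eig) = supp′ , λ F → eig′ F (S? F)
      where
      a = restrict S? c
      b = restrict T? c
      supp′ : Supported S? k a
      supp′ F ¬SF with S? F
      ... | yes sF = supp F λ (_ , ∣F∣≡k) → ¬SF (sF , ∣F∣≡k)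
      ... | no  _  = refl
      decompose : ∀ F → (laplacian U? · c) F ≈ (laplacian S? · a) F + (laplacian T? · b) F
      decompose F = begin
        (laplacian U? · c) F
          ≈⟨ φ-cong (restrict-sum supp) ⟩
        (laplacian U? · (λ F → a F + b F)) F
          ≈⟨ φ-add a b ⟩
        (laplacian U? · a) F + (laplacian U? · b) F
          ≈⟨ +-cong (action-component S? U? S-component (λ G → proj₁ ∘ gate-≉0 (S? G)) F)
                    (action-component T? U? T-component (λ G → proj₁ ∘ gate-≉0 (T? G)) F) ⟩
        (laplacian S? · a) F + (laplacian T? · b) F ∎
        where open IsLinear (·-linear (laplacian U?) F)
      eig′ : ∀ F → Dec (S F) → (laplacian S? · a) F ≈ l * a F
      eig′ F (no ¬sF) = trans (·-zero (laplacian S?) F λ G _ → laplacian-outside S? ¬sF G)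
                              (sym (*-≈0ʳ (gate-no (S? F) ¬sF)))
      eig′ F (yes sF) = begin
        (laplacian S? · a) F
          ≈⟨ +-identityʳ _ ⟨
        (laplacian S? · a) F + 0#
          ≈⟨ +-congˡ (·-zero (laplacian T?) F λ G _ → laplacian-outside T? (disjoint sF) G) ⟨
        (laplacian S? · a) F + (laplacian T? · b) F
          ≈⟨ decompose F ⟨
        (laplacian U? · c) F
          ≈⟨ eig F ⟩
        l * c F
          ≈⟨ *-congˡ (gate-yes (S? F) sF) ⟨
        l * a F ∎

  module _ {N : ℕ} {U V W : Subset N} (P : Pair U) (Q : Pair V) (R : Pair W)
           (V∩W≡∅ : Empty (V ∩ W))
           (split : ∀ {F} → RelativeFace P F → RelativeFace Q F ⊎ RelativeFace R F)
           (left : ∀ {F} → RelativeFace Q F → RelativeFace P F)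
           (R-nonempty : ∀ {F} → RelativeFace R F → ¬ F ≡ ⊥)
           (Q-nonempty : ∀ {F} → RelativeFace Q F → ¬ F ≡ ⊥) where
    private
      avoid : ∀ {G} → G ⊆ V → G ⊆ W → ¬ G ≡ ⊥ → ∀ {A : Set} → A
      avoid G⊆V G⊆W G≢⊥ = contradiction (⊆-disjoint V∩W≡∅ G⊆V G⊆W) G≢⊥

    -- If a face of `Q` and a face of `R` were joined by a facet relation, the smaller set would lie
    -- in both `V` and `W` and hence be empty. The nonemptiness hypotheses rule this out, whichever
    -- of the two is the smaller.
    disjoint-component : IsComponent (RelativeFace Q) (RelativeFace P)
    disjoint-component = record
      { sub  = left
      ; up   = λ {G} {F} GF qG pF → up′ GF qG (split pF)
      ; down = λ {G} {F} GF qF pG → down′ GF qF (split pG)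
      }
      where
      up′ : ∀ {G F} → IsFacet G F → RelativeFace Q G → RelativeFace Q F ⊎ RelativeFace R F → RelativeFace Q F
      up′ GF qG (inj₁ qF) = qF
      up′ GF qG (inj₂ rF) = avoid (face⊆V (proj₁ Q) (proj₁ qG))
        (λ x∈G → face⊆V (proj₁ R) (proj₁ rF) (facet-⊆ GF x∈G)) (Q-nonempty qG)
      down′ : ∀ {G F} → IsFacet G F → RelativeFace Q F → RelativeFace Q G ⊎ RelativeFace R G → RelativeFace Q G
      down′ GF qF (inj₁ qG) = qG
      down′ GF qF (inj₂ rG) = avoid (λ x∈G → face⊆V (proj₁ Q) (proj₁ qF) (facet-⊆ GF x∈G))
        (face⊆V (proj₁ R) (proj₁ rG)) (R-nonempty rG)

  module _ {N : ℕ} {U V W : Subset N} (P : Pair U) (Q : Pair V) (R : Pair W)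
           (V∩W≡∅ : Empty (V ∩ W))
           (split : ∀ {F} → RelativeFace P F → RelativeFace Q F ⊎ RelativeFace R F)
           (left  : ∀ {F} → RelativeFace Q F → RelativeFace P F)
           (right : ∀ {F} → RelativeFace R F → RelativeFace P F)
           (Q-nonempty : ∀ {F} → RelativeFace Q F → ¬ F ≡ ⊥)
           (R-nonempty : ∀ {F} → RelativeFace R F → ¬ F ≡ ⊥) where

    multiplicity-disjoint-union : ∀ k l →
      multiplicity P (k ⊖ 1) l ≡ multiplicity Q (k ⊖ 1) l ℕ.+ multiplicity R (k ⊖ 1) l
    multiplicity-disjoint-union k l = dimension-unique (relative-basis P k l)
      (direct-sum-basis {P = Eigenvector Q? k l} {Q = Eigenvector R? k l} {R = Eigenvector P? k l}
        (extend-eigenvector Q? P? Q-component)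
        (extend-eigenvector R? P? R-component)
        (λ {c} e → restrict Q? c , restrict R? c ,
          restrict-eigenvector Q? R? P? Q-component R-component disjoint split e ,
          restrict-eigenvector R? Q? P? R-component Q-component (λ rF qF → disjoint qF rF) (Sum.swap ∘ split) e ,
          restrict-sum Q? R? P? Q-component R-component disjoint split (proj₁ e))
        (λ F c → gate (Q? F) (c F))
        (λ F → gate-linear (Q? F) F)
        (λ {c} e F → on-Q (proj₁ e) F (Q? F))
        (λ {c} e F → on-R (proj₁ e) F (Q? F))
        (relative-basis Q k l) (relative-basis R k l))
      where
      Q? = relativeFace? Q
      R? = relativeFace? R
      P? = relativeFace? P
      Q-component = disjoint-component P Q R V∩W≡∅ split left R-nonempty Q-nonempty
      R-component = disjoint-component P R Q (≡.subst Empty (∩-comm V W) V∩W≡∅)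
                      (Sum.swap ∘ split) right Q-nonempty R-nonempty
      disjoint : ∀ {F} → RelativeFace Q F → ¬ RelativeFace R F
      disjoint qF rF = Q-nonempty qF
        (⊆-disjoint V∩W≡∅ (face⊆V (proj₁ Q) (proj₁ qF)) (face⊆V (proj₁ R) (proj₁ rF)))
      gate-linear : ∀ {A : Set} (A? : Dec A) (F : Subset N) → IsLinear (λ c → gate A? (c F))
      gate-linear (yes _) F = record
        { φ-cong = λ c≋d → c≋d F ; φ-add = λ _ _ → refl ; φ-scale = λ _ _ → refl }
      gate-linear (no _)  F = record
        { φ-cong = λ _ → refl ; φ-add = λ _ _ → sym (+-identityˡ 0#) ; φ-scale = λ r _ → sym (zeroʳ r) }
      on-Q : ∀ {c} → Supported Q? k c → ∀ F (A? : Dec (RelativeFace Q F)) → gate A? (c F) ≈ c F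
      on-Q supp F (yes _)  = refl
      on-Q supp F (no ¬qF) = sym (supp F (¬qF ∘ proj₁))
      on-R : ∀ {c} → Supported R? k c → ∀ F (A? : Dec (RelativeFace Q F)) → gate A? (c F) ≈ 0#
      on-R supp F (yes qF) = supp F (disjoint qF ∘ proj₁)
      on-R supp F (no _)   = refl

-- The effect of the empty face on L₋₁ and L₀.

indicator : ∀ {A : Set} → Dec A → ℕ
indicator A? = if does A? then 1 else 0

indicator-cong : ∀ {A B : Set} (A? : Dec A) (B? : Dec B) → (A → B) → (B → A) → indicator A? ≡ indicator B?
indicator-cong (yes a) (yes b) _   _   = ≡.refl
indicator-cong (yes a) (no ¬b) A⇒B _   = contradiction (A⇒B a) ¬b
indicator-cong (no ¬a) (yes b) _   B⇒A = contradiction (B⇒A b) ¬a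
indicator-cong (no ¬a) (no ¬b) _   _   = ≡.refl

-- (Δ , ∅-only V) is Δ without its empty face.
∅-only : ∀ {N} (V : Subset N) → Complex V
∅-only V .Face F = F ≡ ⊥
∅-only V .Face? F = F ≟ˢ ⊥
∅-only V .face⊆V ≡.refl x∈⊥ = contradiction x∈⊥ ∉⊥
∅-only V .down-closed ≡.refl G⊆⊥ = ⊆-antisym G⊆⊥ ⊥⊆

module Reduced (ℝ : CompleteOrderedField) where

  open CompleteOrderedField ℝ hiding (_-_; zero)
  open LinearAlgebra ℝ
  open Spectrum ℝ
  open Dimension ℝ
  open Incidence ℝ
  open Laplacians ℝ
  open import Algebra.Properties.Ring ring using (-‿distribˡ-*)
  open IsStrictTotalOrder isStrictTotalOrder using (irrefl; <-respˡ-≈; <-respʳ-≈) renaming (trans to <-trans)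
  open import Relation.Binary.Reasoning.Setoid setoid

  Nonneg : Pred Carrier 0ℓ
  Nonneg x = 0# < x ⊎ x ≈ 0#

  +-pos-nonneg : ∀ {x y} → 0# < x → Nonneg y → 0# < x + y
  +-pos-nonneg {x} {y} 0<x (inj₁ 0<y) = <-trans 0<y (<-respˡ-≈ (+-identityˡ y) (+-monoˡ-< y 0<x))
  +-pos-nonneg {x} {y} 0<x (inj₂ y≈0) = <-respʳ-≈ (sym (trans (+-congˡ y≈0) (+-identityʳ x))) 0<x

  +-nonneg : ∀ {x y} → Nonneg x → Nonneg y → Nonneg (x + y)
  +-nonneg (inj₁ 0<x) y≥0 = inj₁ (+-pos-nonneg 0<x y≥0)
  +-nonneg (inj₂ x≈0) (inj₁ 0<y) = inj₁ (<-respʳ-≈ (sym (trans (+-congʳ x≈0) (+-identityˡ _))) 0<y)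
  +-nonneg (inj₂ x≈0) (inj₂ y≈0) = inj₂ (trans (+-cong x≈0 y≈0) (+-identityˡ 0#))

  +-nonneg-≈0ˡ : ∀ {x y} → Nonneg x → Nonneg y → x + y ≈ 0# → x ≈ 0#
  +-nonneg-≈0ˡ (inj₁ 0<x) y≥0 x+y≈0 = contradiction (+-pos-nonneg 0<x y≥0) (irrefl (sym x+y≈0))
  +-nonneg-≈0ˡ (inj₂ x≈0) _   _     = x≈0

  module _ {X : Set} {f : X → Carrier} (f≥0 : ∀ x → Nonneg (f x)) where

    ∑ₗ-nonneg : ∀ xs → Nonneg (∑ₗ xs f)
    ∑ₗ-nonneg []       = inj₂ refl
    ∑ₗ-nonneg (x ∷ xs) = +-nonneg (f≥0 x) (∑ₗ-nonneg xs)

    ∑ₗ-nonneg-≈0 : ∀ xs → ∑ₗ xs f ≈ 0# → ∀ {x} → x ∈ˡ xs → f x ≈ 0#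
    ∑ₗ-nonneg-≈0 (x ∷ xs) ∑≈0 (Any.here ≡.refl) = +-nonneg-≈0ˡ (f≥0 x) (∑ₗ-nonneg xs) ∑≈0
    ∑ₗ-nonneg-≈0 (x ∷ xs) ∑≈0 (Any.there x∈xs) =
      ∑ₗ-nonneg-≈0 xs (+-nonneg-≈0ˡ (∑ₗ-nonneg xs) (f≥0 x) (trans (+-comm _ _) ∑≈0)) x∈xs

  *-distinct : ∀ {x y z} → ¬ y ≈ z → y * x ≈ z * x → x ≈ 0#
  *-distinct {x} {y} {z} y≉z yx≈zx = *-cancelˡ-≈0
    (λ y-z≈0 → y≉z (begin
      y              ≈⟨ +-identityʳ y ⟨
      y + 0#         ≈⟨ +-congˡ (-‿inverseˡ z) ⟨
      y + (- z + z)  ≈⟨ +-assoc _ _ _ ⟨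
      y + - z + z    ≈⟨ +-congʳ y-z≈0 ⟩
      0# + z         ≈⟨ +-identityˡ z ⟩
      z              ∎))
    (begin
      (y + - z) * x      ≈⟨ distribʳ _ _ _ ⟩
      y * x + - z * x    ≈⟨ +-cong yx≈zx (sym (-‿distribˡ-* z x)) ⟩
      z * x + - (z * x)  ≈⟨ -‿inverseʳ _ ⟩
      0#                 ∎)

  module _ {N : ℕ} where

    ⊗-· : ∀ (A B : Matrix {N}) c F → ((A ⊗ B) · c) F ≈ (A · (B · c)) F
    ⊗-· A B c F = begin
      ∑ˢ (λ G → ∑ˢ (λ H → A F H * B H G) * c G)
        ≈⟨ ∑ˢ-cong {N} (λ G → trans (*-comm _ (c G)) (sym (∑ˢ-* {N} (c G) (λ H → A F H * B H G)))) ⟩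
      ∑ˢ (λ G → ∑ˢ (λ H → c G * (A F H * B H G)))
        ≈⟨ ∑ˢ-swap {N} (λ G H → c G * (A F H * B H G)) ⟩
      ∑ˢ (λ H → ∑ˢ (λ G → c G * (A F H * B H G)))
        ≈⟨ ∑ˢ-cong {N} (λ H → trans
             (∑ˢ-cong {N} (λ G → trans (*-comm (c G) _) (*-assoc (A F H) (B H G) (c G))))
             (∑ˢ-* {N} (A F H) (λ G → B H G * c G))) ⟩
      ∑ˢ (λ H → A F H * ∑ˢ (λ G → B H G * c G)) ∎

    ·-self-adjoint : ∀ (A : Matrix {N}) → (∀ F G → A F G ≈ A G F) → ∀ c d →
                     ∑ˢ (λ F → d F * (A · c) F) ≈ ∑ˢ (λ G → c G * (A · d) G)
    ·-self-adjoint A A-sym c d = begin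
      ∑ˢ (λ F → d F * ∑ˢ (λ G → A F G * c G))
        ≈⟨ ∑ˢ-cong {N} (λ F → sym (∑ˢ-* {N} (d F) (λ G → A F G * c G))) ⟩
      ∑ˢ (λ F → ∑ˢ (λ G → d F * (A F G * c G)))
        ≈⟨ ∑ˢ-swap {N} (λ F G → d F * (A F G * c G)) ⟩
      ∑ˢ (λ G → ∑ˢ (λ F → d F * (A F G * c G)))
        ≈⟨ ∑ˢ-cong {N} (λ G → trans (∑ˢ-cong {N} (λ F → rearrange F G)) (∑ˢ-* {N} (c G) (λ F → A G F * d F))) ⟩
      ∑ˢ (λ G → c G * ∑ˢ (λ F → A G F * d F)) ∎
      where
      rearrange : ∀ F G → d F * (A F G * c G) ≈ c G * (A G F * d F)
      rearrange F G = begin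
        d F * (A F G * c G)  ≈⟨ *-comm _ _ ⟩
        A F G * c G * d F    ≈⟨ *-congʳ (*-comm _ _) ⟩
        c G * A F G * d F    ≈⟨ *-assoc _ _ _ ⟩
        c G * (A F G * d F)  ≈⟨ *-congˡ (*-congʳ (A-sym F G)) ⟩
        c G * (A G F * d F)  ∎

    laplacian-· : ∀ {S : Pred (Subset N) 0ℓ} (S? : Decidable S) c F → let b = boundary S? in
                  (laplacian S? · c) F ≈ (b · ((b ᵀ) · c)) F + ((b ᵀ) · (b · c)) F
    laplacian-· S? c F = begin
      ∑ˢ (λ G → ((b ⊗ b ᵀ) F G + (b ᵀ ⊗ b) F G) * c G)
        ≈⟨ ∑ˢ-cong {N} (λ G → distribʳ (c G) _ _) ⟩
      ∑ˢ (λ G → (b ⊗ b ᵀ) F G * c G + (b ᵀ ⊗ b) F G * c G)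
        ≈⟨ ∑ˢ-+ {N} (λ G → (b ⊗ b ᵀ) F G * c G) (λ G → (b ᵀ ⊗ b) F G * c G) ⟩
      ((b ⊗ b ᵀ) · c) F + ((b ᵀ ⊗ b) · c) F
        ≈⟨ +-cong (⊗-· b (b ᵀ) c F) (⊗-· (b ᵀ) b c F) ⟩
      (b · ((b ᵀ) · c)) F + ((b ᵀ) · (b · c)) F ∎
      where b = boundary S?

    ·-≈0 : ∀ (A : Matrix {N}) {c} → c ≋ (λ _ → 0#) → (A · c) ≋ (λ _ → 0#)
    ·-≈0 A c≈0 F = ∑ˢ-zero {N} λ G → *-≈0ʳ (c≈0 G)

    module _ {S : Pred (Subset N) 0ℓ} (S? : Decidable S) where

      vertexIndicator : Subset N → Carrier
      vertexIndicator = boundary S? ⊥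

      -- Squares of entries that are 0 or 1 once the empty face is present. In this form the count
      -- is by definition the diagonal entry at `⊥` of the product of the boundary with its
      -- transpose, and also the value of `ρ` at `u` below.
      vertexCount : Carrier
      vertexCount = ∑ˢ λ F → vertexIndicator F * vertexIndicator F

      vertex-≉0 : ∀ {F} → ¬ vertexIndicator F ≈ 0# → S F × ∣ F ∣ ≡ 1
      vertex-≉0 u≉0 with boundary-≉0 S? u≉0
      ... | (_ , sF) , facet = sF , ≡.trans (facet-size facet) (≡.cong suc (∣⊥∣≡0 N))

      module _ (S-⊥ : S ⊥) where

        vertex-1 : ∀ {F} → S F → ∣ F ∣ ≡ 1 → vertexIndicator F ≈ 1#
        vertex-1 {F} sF ∣F∣≡1 = trans (gate-yes (S? ⊥ ×-dec S? F) (S-⊥ , sF)) (incidence-⊥ {N} {F} ∣F∣≡1)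

        -- The ordering of the field enters here: a vanishing sum of nonnegative terms has only zero
        -- terms, so a zero count really means that there are no vertices.
        vertexCount≈0 : vertexCount ≈ 0# → vertexIndicator ≋ (λ _ → 0#)
        vertexCount≈0 n≈0 F = decidable-stable (vertexIndicator F ≟ 0#) λ u≉0 →
          let (sF , ∣F∣≡1) = vertex-≉0 u≉0 ; u≈1 = vertex-1 sF ∣F∣≡1 in
          1≉0 (trans (sym (trans (*-cong u≈1 u≈1) (*-identityˡ 1#)))
                     (∑ₗ-nonneg-≈0 square-nonneg (allSubsets N) n≈0 (allSubsets-complete F)))
          where
          square-nonneg : ∀ F → Nonneg (vertexIndicator F * vertexIndicator F)
          square-nonneg F with vertexIndicator F ≟ 0#
          ... | yes u≈0 = inj₂ (*-≈0ˡ u≈0)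
          ... | no  u≉0 = let (sF , ∣F∣≡1) = vertex-≉0 u≉0 ; u≈1 = vertex-1 sF ∣F∣≡1 in
            inj₁ (<-respʳ-≈ (sym (trans (*-cong u≈1 u≈1) (*-identityˡ 1#))) 0<1)

        laplacian-⊥ : ∀ {c} → Supported S? 0 c → (laplacian S? · c) ⊥ ≈ vertexCount * c ⊥
        laplacian-⊥ {c} supp = begin
          (laplacian S? · c) ⊥
            ≈⟨ ∑ˢ-single {N} ⊥ (λ G G≢⊥ → *-≈0ʳ (supp G λ (_ , ∣G∣≡0) → G≢⊥ (∣p∣≡0⇒p≡⊥ ∣G∣≡0))) ⟩
          laplacian S? ⊥ ⊥ * c ⊥
            ≈⟨ *-congʳ (trans (+-congˡ (∑ˢ-zero {N} λ H → *-≈0ˡ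
                 (≈0-by (proj₂ ∘ boundary-≉0 S?) λ f → contradiction (≡.trans (≡.sym (∣⊥∣≡0 N)) (facet-size f)) λ ())))
                 (+-identityʳ _)) ⟩
          vertexCount * c ⊥ ∎

        laplacian-≢⊥ : ∀ {c} → Supported S? 0 c → ∀ {F} → ¬ F ≡ ⊥ → (laplacian S? · c) F ≈ 0#
        laplacian-≢⊥ {c} supp {F} F≢⊥ = ·-zero (laplacian S?) F λ G cG≉0 →
          let ∣G∣≡0 = proj₂ (supported S? supp cG≉0) in
          trans (+-cong (∑ˢ-zero {N} λ H → trans (*-cong-≉0 {x′ = 0#} refl (λ GH≉0 →
                    ≈0-by (proj₂ ∘ boundary-≉0 S?) λ FH → F≢⊥ (∣p∣≡0⇒p≡⊥
                      (≡.trans (ℕ.suc-injective (≡.trans (≡.sym (facet-size FH)) (facet-size (proj₂ (boundary-≉0 S? GH≉0))))) ∣G∣≡0))))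
                    (zeroˡ (boundary S? G H)))
                  (∑ˢ-zero {N} λ H → *-≈0ʳ (≈0-by (proj₂ ∘ boundary-≉0 S?) λ HG →
                    contradiction (≡.trans (≡.sym ∣G∣≡0) (facet-size HG)) λ ())))
                (+-identityˡ 0#)

        eigenbasis-⊥ : ∀ {l} (n≟l : Dec (vertexCount ≈ l)) → Basis (Eigenvector S? 0 l) (indicator n≟l)
        eigenbasis-⊥ {l} (no n≉l) = trivial-basis λ { (supp , eig) F → zero-at supp (eig ⊥) F (F ≟ˢ ⊥) }
          where
          zero-at : ∀ {c} → Supported S? 0 c → (laplacian S? · c) ⊥ ≈ l * c ⊥ → ∀ F → Dec (F ≡ ⊥) → c F ≈ 0#
          zero-at supp eig F (no F≢⊥) = supp F λ (_ , ∣F∣≡0) → F≢⊥ (∣p∣≡0⇒p≡⊥ ∣F∣≡0)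
          zero-at supp eig _ (yes ≡.refl) = *-distinct n≉l (trans (sym (laplacian-⊥ supp)) eig)
        eigenbasis-⊥ {l} (yes n≈l) = basis-transport
          (λ { (r , c≈re) → eigenvector-resp S? (sym ∘ c≈re) (IsSubspace.scale (eigenvector-subspace S?) r e-eigen) })
          (λ {c} e-eig → c ⊥ , multiple (proj₁ e-eig))
          (multiple-basis λ e≈0 → 1≉0 (trans (sym (gate-yes (⊥ {N} ≟ˢ ⊥) ≡.refl)) (e≈0 ⊥)))
          where
          e : Subset N → Carrier
          e F = gate (F ≟ˢ ⊥) 1#
          e-supp : Supported S? 0 e
          e-supp F ¬SF = gate-no (F ≟ˢ ⊥) λ { ≡.refl → ¬SF (S-⊥ , ∣⊥∣≡0 N) }
          e-eig : ∀ F → Dec (F ≡ ⊥) → (laplacian S? · e) F ≈ l * e F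
          e-eig F (yes ≡.refl) = trans (laplacian-⊥ e-supp) (*-congʳ n≈l)
          e-eig F (no F≢⊥)     = trans (laplacian-≢⊥ e-supp F≢⊥) (sym (*-≈0ʳ (gate-no (F ≟ˢ ⊥) F≢⊥)))
          e-eigen : Eigenvector S? 0 l e
          e-eigen = e-supp , λ F → e-eig F (F ≟ˢ ⊥)
          multiple : ∀ {c} → Supported S? 0 c → c ≋ (λ F → c ⊥ * e F)
          multiple supp F with F ≟ˢ ⊥
          ... | yes ≡.refl = sym (*-identityʳ _)
          ... | no F≢⊥     = trans (supp F λ (_ , ∣F∣≡0) → F≢⊥ (∣p∣≡0⇒p≡⊥ ∣F∣≡0)) (sym (zeroʳ _))

    module _ {S T : Pred (Subset N) 0ℓ} (S? : Decidable S) (T? : Decidable T) (S-⊥ : S ⊥)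
             (S-closed : ∀ {G F} → IsFacet G F → S F → S G)
             (to : ∀ {F} → S F → ¬ F ≡ ⊥ → T F)
             (from : ∀ {F} → T F → S F × ¬ F ≡ ⊥) where
      private
        u = vertexIndicator S?
        n = vertexCount S?
        ρ : (Subset N → Carrier) → Carrier
        ρ c = ∑ˢ λ G → u G * c G
        bS = boundary S?
        bT = boundary T?
        LS = laplacian S?
        LT = laplacian T?

      ρ-linear : IsLinear ρ
      ρ-linear = ∑ˢ-linear u

      size≢0 : ∀ {F : Subset N} {k} → ∣ F ∣ ≡ suc k → ¬ F ≡ ⊥
      size≢0 ∣F∣≡1+k ≡.refl = contradiction (≡.trans (≡.sym (∣⊥∣≡0 N)) ∣F∣≡1+k) λ ()

      ¬T-size-0 : ∀ {F} → ∣ F ∣ ≡ 0 → ¬ T F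
      ¬T-size-0 ∣F∣≡0 tF = proj₂ (from tF) (∣p∣≡0⇒p≡⊥ ∣F∣≡0)

      boundary-reduced : ∀ {G F} → ¬ G ≡ ⊥ → bS G F ≈ bT G F
      boundary-reduced {G} {F} G≢⊥ = boundary-cong S? T?
        (λ { GF (sG , sF) → to sG G≢⊥ , to sF (size≢0 (facet-size GF)) })
        (λ { _ (tG , tF) → proj₁ (from tG) , proj₁ (from tF) })

      -- The only facet of a vertex is the empty set. So the lower half of the Laplacian of `S` has
      -- the single term `u F * u G`, and that of `T` has none. The upper halves agree because the
      -- facets of an edge are nonempty.
      laplacian-reduced : ∀ F {G} → ∣ G ∣ ≡ 1 → LS F G ≈ LT F G + u F * u G
      laplacian-reduced F {G} ∣G∣≡1 = trans (+-cong up down) (sym (+-assoc _ _ _))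
        where
        ∣facet∣ : ∀ {H} → IsFacet H G → ∣ H ∣ ≡ 0
        ∣facet∣ HG = ℕ.suc-injective (≡.trans (≡.sym (facet-size HG)) ∣G∣≡1)
        down : (bS ᵀ ⊗ bS) F G ≈ (bT ᵀ ⊗ bT) F G + u F * u G
        down = begin
          ∑ˢ (λ H → bS H F * bS H G)
            ≈⟨ ∑ˢ-single {N} ⊥ (λ H H≢⊥ → *-≈0ʳ (≈0-by (proj₂ ∘ boundary-≉0 S?) λ HG →
                 H≢⊥ (∣p∣≡0⇒p≡⊥ (∣facet∣ HG)))) ⟩
          u F * u G
            ≈⟨ +-identityˡ _ ⟨
          0# + u F * u G
            ≈⟨ +-congʳ (∑ˢ-zero {N} λ H → *-≈0ʳ (≈0-by (boundary-≉0 T?) λ { ((tH , _) , HG) →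
                 ¬T-size-0 (∣facet∣ HG) tH })) ⟨
          ∑ˢ (λ H → bT H F * bT H G) + u F * u G ∎
        up : (bS ⊗ bS ᵀ) F G ≈ (bT ⊗ bT ᵀ) F G
        up = ∑ˢ-cong {N} λ H → *-cong-≉0 (boundary-reduced (size≢0 ∣G∣≡1)) λ GH≉0 →
          up-row (≡.trans (facet-size (proj₂ (boundary-≉0 T? GH≉0))) (≡.cong suc ∣G∣≡1))
          where
          up-row : ∀ {H} → ∣ H ∣ ≡ 2 → bS F H ≈ bT F H
          -- `boundary-reduced` says nothing about the row of the empty set, but that row is zero at
          -- every set of size 2.
          up-row {H} ∣H∣≡2 with F ≟ˢ ⊥
          ... | no F≢⊥     = boundary-reduced F≢⊥
          ... | yes ≡.refl = trans (≈0-by (proj₂ ∘ boundary-≉0 S?) wrong) (sym (≈0-by (proj₂ ∘ boundary-≉0 T?) wrong))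
            where
            wrong : ¬ IsFacet ⊥ H
            wrong f = contradiction (≡.trans (≡.sym ∣H∣≡2) (≡.trans (facet-size f) (≡.cong suc (∣⊥∣≡0 N)))) λ ()

      supported-reduced : ∀ {c} → Supported S? 1 c → Supported T? 1 c
      supported-reduced supp F ¬TF = supp F λ (sF , ∣F∣≡1) → ¬TF (to sF (size≢0 ∣F∣≡1) , ∣F∣≡1)

      supported-unreduced : ∀ {c} → Supported T? 1 c → Supported S? 1 c
      supported-unreduced supp F ¬SF = supp F λ (tF , ∣F∣≡1) → ¬SF (proj₁ (from tF) , ∣F∣≡1)

      action-reduced : ∀ {c} → Supported S? 1 c → ∀ F → (LS · c) F ≈ (LT · c) F + ρ c * u F
      action-reduced {c} supp F = begin
        ∑ˢ (λ G → LS F G * c G)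
          ≈⟨ ∑ˢ-cong {N} (λ G → *-cong-≉0 refl λ cG≉0 → laplacian-reduced F (proj₂ (supported S? supp cG≉0))) ⟩
        ∑ˢ (λ G → (LT F G + u F * u G) * c G)
          ≈⟨ ∑ˢ-cong {N} (λ G → trans (distribʳ (c G) _ _) (+-congˡ (*-assoc (u F) (u G) (c G)))) ⟩
        ∑ˢ (λ G → LT F G * c G + u F * (u G * c G))
          ≈⟨ ∑ˢ-+ {N} (λ G → LT F G * c G) (λ G → u F * (u G * c G)) ⟩
        (LT · c) F + ∑ˢ (λ G → u F * (u G * c G))
          ≈⟨ +-congˡ (trans (∑ˢ-* {N} (u F) (λ G → u G * c G)) (*-comm _ _)) ⟩
        (LT · c) F + ρ c * u F ∎

      -- ∂₀ ∂₁ = 0.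
      coboundary-u : ((bT ᵀ) · u) ≋ (λ _ → 0#)
      coboundary-u H with T? H ×-dec (∣ H ∣ ℕ.≟ 2)
      ... | no ¬edge = ∑ˢ-zero {N} λ G → trans (*-cong-≉0 {x′ = 0#} refl λ uG≉0 →
              ≈0-by (boundary-≉0 T?) λ { ((_ , tH) , GH) →
                ¬edge (tH , ≡.trans (facet-size GH) (≡.cong suc (proj₂ (vertex-≉0 S? uG≉0)))) })
              (zeroˡ (u G))
      ... | yes (tH , ∣H∣≡2) = begin
        ∑ˢ (λ G → bT G H * u G)      ≈⟨ ∑ˢ-cong {N} term ⟩
        ∑ˢ (λ G → incidence G H)     ≈⟨ ∑-incidence H ⟩
        alternating ∣ H ∣            ≡⟨ ≡.cong alternating ∣H∣≡2 ⟩
        alternating 2                ≈⟨ alternating-2 ⟩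
        0#                           ∎
        where
        term : ∀ G → bT G H * u G ≈ incidence G H
        term G with incidence G H ≟ 0#
        ... | yes inc≈0 = trans (*-≈0ˡ (gate-zero (T? G ×-dec T? H) inc≈0)) (sym inc≈0)
        ... | no inc≉0  = trans (*-cong (gate-yes (T? G ×-dec T? H) (to sG (size≢0 ∣G∣≡1) , tH)) (vertex-1 S? S-⊥ sG ∣G∣≡1))
                                (*-identityʳ _)
          where
          GH = incidence-≉0 G H inc≉0
          sG : S G
          sG = S-closed GH (proj₁ (from tH))
          ∣G∣≡1 : ∣ G ∣ ≡ 1
          ∣G∣≡1 = ℕ.suc-injective (≡.trans (≡.sym (facet-size GH)) ∣H∣≡2)

      boundary-u : (bT · u) ≋ (λ _ → 0#)
      boundary-u H = ∑ˢ-zero {N} λ G → trans (*-cong-≉0 {x′ = 0#} refl λ uG≉0 →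
        ≈0-by (boundary-≉0 T?) λ { ((tH , _) , HG) →
          ¬T-size-0 (ℕ.suc-injective (≡.trans (≡.sym (facet-size HG)) (proj₂ (vertex-≉0 S? uG≉0)))) tH })
        (zeroˡ (u G))

      -- `u` is harmonic: the coboundary kills it because the two end points of an edge carry
      -- opposite signs, and the boundary kills it because `T` lacks the empty set.
      laplacian-u : (LT · u) ≋ (λ _ → 0#)
      laplacian-u F = trans (laplacian-· T? u F)
        (trans (+-cong (·-≈0 bT coboundary-u F) (·-≈0 (bT ᵀ) boundary-u F)) (+-identityˡ 0#))

      -- Symmetry moves the Laplacian from `c` onto `u`.
      ρ-laplacian : ∀ c → ρ (LT · c) ≈ 0#
      ρ-laplacian c = trans (·-self-adjoint LT (laplacian-sym T?) c u)
                            (∑ˢ-zero {N} λ G → *-≈0ʳ (laplacian-u G))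

      u-supported : Supported S? 1 u
      u-supported F ¬SF = ≈0-by (vertex-≉0 S?) ¬SF

      -- On the kernel of `ρ` the rank one term disappears, so there the two eigenvector conditions
      -- coincide. Any difference between the eigenspaces lies outside that kernel.
      reduce : ∀ {l c} → ρ c ≈ 0# → Eigenvector S? 1 l c → Eigenvector T? 1 l c
      reduce {l} {c} ρc≈0 (supp , eig) = supported-reduced supp , λ F → begin
        (LT · c) F                ≈⟨ +-identityʳ _ ⟨
        (LT · c) F + 0#           ≈⟨ +-congˡ (*-≈0ˡ ρc≈0) ⟨
        (LT · c) F + ρ c * u F    ≈⟨ action-reduced supp F ⟨
        (LS · c) F                ≈⟨ eig F ⟩
        l * c F                   ∎

      unreduce : ∀ {l c} → ρ c ≈ 0# → Eigenvector T? 1 l c → Eigenvector S? 1 l c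
      unreduce {l} {c} ρc≈0 (supp , eig) = supported-unreduced supp , λ F → begin
        (LS · c) F                ≈⟨ action-reduced (supported-unreduced supp) F ⟩
        (LT · c) F + ρ c * u F    ≈⟨ +-congˡ (*-≈0ˡ ρc≈0) ⟩
        (LT · c) F + 0#           ≈⟨ +-identityʳ _ ⟩
        (LT · c) F                ≈⟨ eig F ⟩
        l * c F                   ∎

      -- Applying `ρ` to the eigenvalue equation gives 0 = l ρ(c), since `ρ` kills the image of the
      -- Laplacian of `T`.
      ρ-reduced : ∀ {l c} → ¬ l ≈ 0# → Eigenvector T? 1 l c → ρ c ≈ 0#
      ρ-reduced {l} {c} l≉0 (_ , eig) = *-cancelˡ-≈0 l≉0
        (trans (sym (φ-scale l c)) (trans (φ-cong (sym ∘ eig)) (ρ-laplacian c)))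
        where open IsLinear ρ-linear

      -- Applying `ρ` to the eigenvalue equation gives n ρ(c) = l ρ(c): only the rank one term
      -- survives, and `ρ u` is n.
      ρ-unreduced : ∀ {l c} → ¬ n ≈ l → Eigenvector S? 1 l c → ρ c ≈ 0#
      ρ-unreduced {l} {c} n≉l (supp , eig) = *-distinct n≉l (begin
        n * ρ c                               ≈⟨ *-comm _ _ ⟩
        ρ c * n                               ≈⟨ φ-scale (ρ c) u ⟨
        ρ (λ F → ρ c * u F)                   ≈⟨ +-identityˡ _ ⟨
        0# + ρ (λ F → ρ c * u F)              ≈⟨ +-congʳ (ρ-laplacian c) ⟨
        ρ (LT · c) + ρ (λ F → ρ c * u F)      ≈⟨ φ-add (LT · c) (λ F → ρ c * u F) ⟨
        ρ (λ F → (LT · c) F + ρ c * u F)      ≈⟨ φ-cong (action-reduced supp) ⟨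
        ρ (LS · c)                            ≈⟨ φ-cong eig ⟩
        ρ (λ F → l * c F)                     ≈⟨ φ-scale l c ⟩
        l * ρ c                               ∎)
        where open IsLinear ρ-linear

      u-reduced : ∀ {l} → l ≈ 0# → Eigenvector T? 1 l u
      u-reduced l≈0 = supported-reduced u-supported , λ F → trans (laplacian-u F) (sym (*-≈0ˡ l≈0))

      u-unreduced : ∀ {l} → n ≈ l → Eigenvector S? 1 l u
      u-unreduced n≈l = u-supported , λ F → trans (action-reduced u-supported F)
        (trans (+-cong (laplacian-u F) (*-congʳ n≈l)) (+-identityˡ _))

      -- L₀ is the reduced L₀ plus the rank one matrix u uᵀ, and u spans
      -- the difference: it has eigenvalue 0 for the former, n for the latter.
      dimension-reduced : ∀ {l a b} → Basis (Eigenvector S? 1 l) a → Basis (Eigenvector T? 1 l) b →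
        (l≟0 : Dec (l ≈ 0#)) (n≟l : Dec (n ≈ l)) → a ℕ.+ indicator l≟0 ≡ b ℕ.+ indicator n≟l
      dimension-reduced {l} {a} {b} A B l≟0 n≟l = by-cases (n ≟ 0#) l≟0 n≟l
        where
        same : (∀ {c} → Eigenvector S? 1 l c → ρ c ≈ 0#) → (∀ {c} → Eigenvector T? 1 l c → ρ c ≈ 0#) → a ≡ b
        same ρS ρT = dimension-unique A
          (basis-transport (λ e → unreduce (ρT e) e) (λ e → reduce (ρS e) e) B)
        by-cases : Dec (n ≈ 0#) → (l≟0 : Dec (l ≈ 0#)) (n≟l : Dec (n ≈ l)) → a ℕ.+ indicator l≟0 ≡ b ℕ.+ indicator n≟l
        -- Of the equations n = 0, l = 0 and n = l, any two imply the third, which excludes three of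
        -- the eight cases.
        by-cases (yes n≈0) (yes l≈0) (no n≉l)  = contradiction (trans n≈0 (sym l≈0)) n≉l
        by-cases (yes n≈0) (no l≉0)  (yes n≈l) = contradiction (trans (sym n≈l) n≈0) l≉0
        by-cases (no n≉0)  (yes l≈0) (yes n≈l) = contradiction (trans n≈l l≈0) n≉0
        -- No vertices, so `u` and hence `ρ` are zero, and the two eigenspaces coincide.
        by-cases (yes n≈0) (yes _)   (yes _)   = ≡.cong (ℕ._+ 1) (same (λ _ → ρ≈0) (λ _ → ρ≈0))
          where
          ρ≈0 : ∀ {c} → ρ c ≈ 0#
          ρ≈0 = ∑ˢ-zero {N} λ G → *-≈0ˡ (vertexCount≈0 S? S-⊥ n≈0 G)
        by-cases (yes _)   (no l≉0)  (no n≉l)  = ≡.cong (ℕ._+ 0) (same (ρ-unreduced n≉l) (ρ-reduced l≉0))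
        by-cases (no _)    (no l≉0)  (no n≉l)  = ≡.cong (ℕ._+ 0) (same (ρ-unreduced n≉l) (ρ-reduced l≉0))
        -- The kernel without the empty face contains `u` in addition to the eigenspace of `S`.
        by-cases (no n≉0)  (yes l≈0) (no n≉l)  = ≡.trans (ℕ.+-comm a 1) (≡.trans (dimension-unique
          (hyperplane-basis (eigenvector-subspace T?) ρ-linear (u-reduced l≈0) n≉0 (eigenvector-resp T?)
            (λ e → reduce (ρ-unreduced n≉l e) e) (ρ-unreduced n≉l) (λ e ρ≈0 → unreduce ρ≈0 e) A) B)
          (≡.sym (ℕ.+-identityʳ b)))
        -- Here the roles are exchanged: `u` is the extra eigenvector with the empty face present.
        by-cases (no n≉0)  (no l≉0)  (yes n≈l) = ≡.trans (ℕ.+-identityʳ a) (≡.trans (dimension-unique A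
          (hyperplane-basis (eigenvector-subspace S?) ρ-linear (u-unreduced n≈l) n≉0 (eigenvector-resp S?)
            (λ e → unreduce (ρ-reduced l≉0 e) e) (ρ-reduced l≉0) (λ e ρ≈0 → reduce ρ≈0 e) B))
          (ℕ.+-comm 1 b))

    module _ {S S′ : Pred (Subset N) 0ℓ} (S? : Decidable S) (S′? : Decidable S′) (e : Fin N)
             (S-⊥ : S ⊥) (S-e : S ⁅ e ⁆)
             (to : ∀ {F} → S F → e ∉ F → S′ F) (from : ∀ {F} → S′ F → S F × e ∉ F) where

      vertexCount-delete : vertexCount S? ≈ vertexCount S′? + 1#
      vertexCount-delete = begin
        vertexCount S?
          ≈⟨ ∑ˢ-cong {N} term ⟩
        ∑ˢ (λ F → u′ F * u′ F + gate (F ≟ˢ ⁅ e ⁆) 1#)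
          ≈⟨ ∑ˢ-+ {N} (λ F → u′ F * u′ F) (λ F → gate (F ≟ˢ ⁅ e ⁆) 1#) ⟩
        vertexCount S′? + ∑ˢ (λ F → gate (F ≟ˢ ⁅ e ⁆) 1#)
          ≈⟨ +-congˡ (trans (∑ˢ-single {N} ⁅ e ⁆ (λ F F≢ → gate-no (F ≟ˢ ⁅ e ⁆) F≢))
                            (gate-yes (⁅ e ⁆ ≟ˢ ⁅ e ⁆) ≡.refl)) ⟩
        vertexCount S′? + 1# ∎
        where
        u  = vertexIndicator S?
        u′ = vertexIndicator S′?
        term : ∀ F → u F * u F ≈ u′ F * u′ F + gate (F ≟ˢ ⁅ e ⁆) 1#
        term F with F ≟ˢ ⁅ e ⁆
        ... | yes ≡.refl = trans (*-cong u≈1 u≈1) (trans (*-identityˡ 1#) (trans (sym (+-identityˡ 1#))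
                (+-congʳ (sym (*-≈0ˡ (≈0-by (vertex-≉0 S′?) λ (s′ , _) → proj₂ (from s′) (x∈⁅x⁆ e)))))))
          where
          u≈1 : u ⁅ e ⁆ ≈ 1#
          u≈1 = vertex-1 S? S-⊥ S-e (∣⁅x⁆∣≡1 e)
        ... | no F≢⁅e⁆ = trans (*-cong u≈u′ u≈u′) (sym (+-identityʳ _))
          where
          u≈u′ : u F ≈ u′ F
          u≈u′ = boundary-cong S? S′?
            (λ { ⊥F (_ , sF) → to S-⊥ ∉⊥ , to sF λ e∈F →
              F≢⁅e⁆ (x∈p∧∣p∣≡1⇒p≡⁅x⁆ e∈F (≡.trans (facet-size ⊥F) (≡.cong suc (∣⊥∣≡0 N)))) })
            (λ { _ (s′⊥ , s′F) → proj₁ (from s′⊥) , proj₁ (from s′F) })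

-- Integer identities for combining multiplicities.

module Arithmetic where
  open ℤ.+-*-Solver
  open import Data.Integer.Base using (_+_)
  open ≡.≡-Reasoning

  -- `a` and `d` are multiplicities in the union and in Δ, `s` and `g` those of Δ and Γ without the
  -- empty face, `x` and `y` those in degree -1 of the union and Δ, and `z` is [l = 0]. Subtracting
  -- the equations removes the unknowns `s` and `z`.
  eliminate : ∀ {a} d s g x y z → a + z ≡ (s + g) + x → d + z ≡ s + y → a ≡ (d + g) + (x ℤ.- y)
  eliminate {a} d s g x y z az≡ dz≡ = ≡.sym (begin
    (d + g) + (x ℤ.- y)
      ≡⟨ solve 5 (λ d g x y z → (d :+ g) :+ (x :- y) := (d :+ z) :+ (g :+ (x :- y) :- z)) ≡.refl d g x y z ⟩
    (d + z) + (g + (x ℤ.- y) ℤ.- z)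
      ≡⟨ ≡.cong (_+ (g + (x ℤ.- y) ℤ.- z)) dz≡ ⟩
    (s + y) + (g + (x ℤ.- y) ℤ.- z)
      ≡⟨ solve 5 (λ s g x y z → (s :+ y) :+ (g :+ (x :- y) :- z) := ((s :+ g) :+ x) :- z) ≡.refl s g x y z ⟩
    ((s + g) + x) ℤ.- z
      ≡⟨ ≡.cong (ℤ._- z) az≡ ⟨
    (a + z) ℤ.- z
      ≡⟨ solve 2 (λ a z → (a :+ z) :- z := a) ≡.refl a z ⟩
    a ∎)

  -- Unprimed letters are taken at l, primed ones at l - 1. The contribution of Γ enters as g = g′ +
  -- (g - g′), split between the deletion term and the factor 1 - q. The correction `w` is the same
  -- before and after deletion, so it cancels.
  combine : ∀ {a a′} d d′ g g′ p r r′ w →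
            a ≡ (d + g) + w → a′ ≡ (d′ + g′) + w → d ≡ d′ + p + (r ℤ.- r′) →
            a ≡ a′ + p + ((r + g) ℤ.- (r′ + g′))
  combine _ d′ g g′ p r r′ w ≡.refl ≡.refl ≡.refl =
    solve 7 (λ d′ p r r′ w g g′ →
      ((d′ :+ p :+ (r :- r′)) :+ g) :+ w := ((d′ :+ g′) :+ w) :+ p :+ ((r :+ g) :- (r′ :+ g′)))
      ≡.refl d′ p r r′ w g g′

  assemble : ∀ {a p p₁ r r₁ r′ r′₁} → p₁ ≡ p → r₁ ≡ r → r′₁ ≡ r′ →
             + a + + p + (+ r ℤ.- + r′) ≡ + a + + p₁ + (+ r₁ ℤ.- + r′₁)
  assemble ≡.refl ≡.refl ≡.refl = ≡.refl

  loop : ∀ a b → a ≡ b + ℤ.0ℤ + (a ℤ.- b)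
  loop = solve 2 (λ a b → a := b :+ con ℤ.0ℤ :+ (a :- b)) ≡.refl

open Arithmetic

-- The spectral recursion for a disjoint union.

module Recursion (ℝ : CompleteOrderedField) where

  open CompleteOrderedField ℝ hiding (_-_; zero)
  open Spectrum ℝ
  open Laplacians ℝ
  open Additivity ℝ
  open Reduced ℝ

  module _ {N : ℕ} {V : Subset N} (Δ : Complex V) where

    multiplicity₋₁ : (⊥∈Δ : Face Δ ⊥) → ∀ l →
      multiplicity (Δ , ∅ᶜ V) (0 ⊖ 1) l ≡ indicator (vertexCount (relativeFace? (Δ , ∅ᶜ V)) ≟ l)
    multiplicity₋₁ ⊥∈Δ l = Dimension.dimension-unique ℝ (relative-basis (Δ , ∅ᶜ V) 0 l)
      (eigenbasis-⊥ (relativeFace? (Δ , ∅ᶜ V)) (⊥∈Δ , λ ()) (_ ≟ l))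

    multiplicity₀ : Face Δ ⊥ → ∀ l →
      multiplicity (Δ , ∅ᶜ V) (1 ⊖ 1) l ℕ.+ indicator (l ≟ 0#) ≡
      multiplicity (Δ , ∅-only V) (1 ⊖ 1) l ℕ.+ multiplicity (Δ , ∅ᶜ V) (0 ⊖ 1) l
    multiplicity₀ ⊥∈Δ l = ≡.trans
      (dimension-reduced (relativeFace? (Δ , ∅ᶜ V)) (relativeFace? (Δ , ∅-only V)) (⊥∈Δ , λ ())
        (λ { GF (f , _) → down-closed Δ f (facet-⊆ GF) , λ () })
        (λ { (f , _) F≢⊥ → f , F≢⊥ })
        (λ { (f , F≢⊥) → (f , λ ()) , F≢⊥ })
        (relative-basis (Δ , ∅ᶜ V) 1 l) (relative-basis (Δ , ∅-only V) 1 l)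
        (l ≟ 0#) (_ ≟ l))
      (≡.cong (multiplicity (Δ , ∅-only V) (1 ⊖ 1) l ℕ.+_) (≡.sym (multiplicity₋₁ ⊥∈Δ l)))

    -- The Laplacian on sets of size k + 2 reaches down only to size k + 1, so it never meets the
    -- empty face.
    multiplicity₊ : ∀ k l → multiplicity (Δ , ∅ᶜ V) (suc (suc k) ⊖ 1) l ≡
                            multiplicity (Δ , ∅-only V) (suc (suc k) ⊖ 1) l
    multiplicity₊ k l = multiplicity-cong (Δ , ∅ᶜ V) (suc (suc k)) l (Δ , ∅-only V)
      (λ { F k≤ (f , _) → f , λ { ≡.refl → contradiction (≡.subst (suc k ℕ.≤_) (∣⊥∣≡0 N) (ℕ.s≤s⁻¹ k≤)) λ () } })
      (λ { _ _ (f , _) → f , λ () })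

  module _ {N : ℕ} {V : Subset N} (Δ : Complex V) where

    multiplicity₋₁-deletion : ∀ {e} → Face Δ ⁅ e ⁆ → ∀ l →
      multiplicity (Δ , ∅ᶜ V) (0 ⊖ 1) l ≡ multiplicity (deletion Δ e , ∅ᶜ (V - e)) (0 ⊖ 1) (l + - 1#)
    multiplicity₋₁-deletion {e} e∈Δ l = ≡.trans (multiplicity₋₁ Δ ⊥∈Δ l) (≡.trans
      (indicator-cong (n ≟ l) (n′ ≟ l + - 1#)
        (λ n≈l → sym (trans (+-congʳ (trans (sym n≈l) n≈n′+1)) (cancelʳ n′ 1# (- 1#) (-‿inverseʳ 1#))))
        (λ n′≈l-1 → trans n≈n′+1 (trans (+-congʳ n′≈l-1) (cancelʳ l (- 1#) 1# (-‿inverseˡ 1#)))))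
      (≡.sym (multiplicity₋₁ (deletion Δ e) (⊥∈Δ , ∉⊥) (l + - 1#))))
      where
      n  = vertexCount (relativeFace? (Δ , ∅ᶜ V))
      n′ = vertexCount (relativeFace? (deletion Δ e , ∅ᶜ (V - e)))
      ⊥∈Δ : Face Δ ⊥
      ⊥∈Δ = down-closed Δ e∈Δ ⊥⊆
      cancelʳ : ∀ x y z → y + z ≈ 0# → x + y + z ≈ x
      cancelʳ x y z y+z≈0 = trans (+-assoc x y z) (trans (+-congˡ y+z≈0) (+-identityʳ x))
      n≈n′+1 : n ≈ n′ + 1#
      n≈n′+1 = vertexCount-delete (relativeFace? (Δ , ∅ᶜ V)) (relativeFace? (deletion Δ e , ∅ᶜ (V - e))) e
        (⊥∈Δ , λ ()) (e∈Δ , λ ()) (λ { (f , _) e∉F → (f , e∉F) , λ () }) (λ { ((f , e∉F) , _) → (f , λ ()) , e∉F })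

    contraction-loop : ∀ {e G} → ¬ Face Δ ⁅ e ⁆ → ¬ Face (contraction Δ e) G
    contraction-loop e∉Δ (F , f , e∈F , _) = e∉Δ (down-closed Δ f (⁅x⁆⊆p e∈F))

    -- No face contains `e`, so the contraction has no faces, while the deletion and the relative
    -- pair both have exactly the faces of Δ. The recursion reads S = q S + (1 - q) S.
    recursion-loop : ∀ {e} → ¬ Face Δ ⁅ e ⁆ → SpectralRecursionAt Δ e
    recursion-loop {e} e∉Δ k l = ≡.trans (loop (+ m k l) (+ m k l′)) (≡.cong₂ ℤ._+_
      (≡.cong₂ ℤ._+_ (≡.cong +_ (deleted k l′)) (≡.sym (contracted k)))
      (≡.cong₂ ℤ._-_ (≡.cong +_ (relative k l)) (≡.cong +_ (relative k l′))))
      where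
      l′ = l + - 1#
      Δ-e = deletion Δ e
      Δ/e = contraction Δ e
      m : ℕ → Carrier → ℕ
      m k l = multiplicity (Δ , ∅ᶜ V) (k ⊖ 1) l
      avoids : ∀ {F} → Face Δ F → e ∉ F
      avoids f e∈F = e∉Δ (down-closed Δ f (⁅x⁆⊆p e∈F))
      deleted : ∀ k l → m k l ≡ multiplicity (Δ-e , ∅ᶜ (V - e)) (k ⊖ 1) l
      deleted k l = multiplicity-cong (Δ , ∅ᶜ V) k l (Δ-e , ∅ᶜ (V - e))
        (λ { _ _ (f , _) → (f , avoids f) , λ () }) (λ { _ _ ((f , _) , _) → f , λ () })
      relative : ∀ k l → m k l ≡ multiplicity (Δ-e , Δ/e) (k ⊖ 1) l
      relative k l = multiplicity-cong (Δ , ∅ᶜ V) k l (Δ-e , Δ/e)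
        (λ { _ _ (f , _) → (f , avoids f) , contraction-loop e∉Δ }) (λ { _ _ ((f , _) , _) → f , λ () })
      contracted : ∀ k → (t· spectrumPolynomialᶜ Δ/e) k l′ ≡ ℤ.0ℤ
      contracted zero    = ≡.refl
      contracted (suc k) = ≡.cong +_ (multiplicity-unsupported (Δ/e , ∅ᶜ (V - e)) k l′
        (λ { _ _ (f , _) → contraction-loop e∉Δ f }))

  module _ {N : ℕ} {U V W : Subset N} (X : Complex U) (Δ : Complex V) (Γ : Complex W)
           (V∩W≡∅ : Empty (V ∩ W))
           (split : ∀ {F} → Face X F → Face Δ F ⊎ Face Γ F)
           (left  : ∀ {F} → Face Δ F → Face X F)
           (right : ∀ {F} → Face Γ F → Face X F)
           {e : Fin N} (e∈Δ : Face Δ ⁅ e ⁆) where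
    private
      X-e = deletion X e
      X/e = contraction X e
      Δ-e = deletion Δ e
      Δ/e = contraction Δ e

      e∈V : e ∈ V
      e∈V = face⊆V Δ e∈Δ (x∈⁅x⁆ e)

      Γ-avoids : ∀ {F} → Face Γ F → e ∉ F
      Γ-avoids f e∈F = V∩W≡∅ (e , x∈p∩q⁺ (e∈V , face⊆V Γ f e∈F))

      ⊥∈Δ : Face Δ ⊥
      ⊥∈Δ = down-closed Δ e∈Δ ⊥⊆

      V-e∩W≡∅ : Empty ((V - e) ∩ W)
      V-e∩W≡∅ (x , x∈) with x∈p∩q⁻ (V - e) W x∈
      ... | x∈V-e , x∈W = V∩W≡∅ (x , x∈p∩q⁺ (p─q⊆p V ⁅ e ⁆ x∈V-e , x∈W))

      contraction⇒ : ∀ {G} → Face X/e G → Face Δ/e G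
      contraction⇒ {G} (F , f , e∈F , G≡F-e) = from-split (split f)
        where
        from-split : Face Δ F ⊎ Face Γ F → Face Δ/e G
        from-split (inj₁ d) = F , d , e∈F , G≡F-e
        from-split (inj₂ g) = contradiction e∈F (Γ-avoids g)

      contraction⇐ : ∀ {G} → Face Δ/e G → Face X/e G
      contraction⇐ (F , d , e∈F , G≡F-e) = F , left d , e∈F , G≡F-e

      ⊥∈Δ/e : Face Δ/e ⊥
      ⊥∈Δ/e = ⁅ e ⁆ , e∈Δ , x∈⁅x⁆ e , ≡.sym (≡.trans (≡.cong (_- e) (≡.sym (∪-identityˡ ⁅ e ⁆))) (insert-delete ⊥ e ∉⊥))

      Γ∩Δ/e : ∀ {F} → Face Γ F → Face Δ/e F → F ≡ ⊥
      Γ∩Δ/e g d = ⊆-disjoint V-e∩W≡∅ (face⊆V Δ/e d) (face⊆V Γ g)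

      reduced-union : ∀ k l → multiplicity (X , ∅-only U) (k ⊖ 1) l ≡
                      multiplicity (Δ , ∅-only V) (k ⊖ 1) l ℕ.+ multiplicity (Γ , ∅-only W) (k ⊖ 1) l
      reduced-union = multiplicity-disjoint-union (X , ∅-only U) (Δ , ∅-only V) (Γ , ∅-only W) V∩W≡∅
        (λ { (f , F≢⊥) → Sum.map (_, F≢⊥) (_, F≢⊥) (split f) })
        (λ { (d , F≢⊥) → left d , F≢⊥ }) (λ { (g , F≢⊥) → right g , F≢⊥ }) proj₂ proj₂

      reduced-deletion : ∀ k l → multiplicity (X-e , ∅-only (U - e)) (k ⊖ 1) l ≡
                         multiplicity (Δ-e , ∅-only (V - e)) (k ⊖ 1) l ℕ.+ multiplicity (Γ , ∅-only W) (k ⊖ 1) l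
      reduced-deletion = multiplicity-disjoint-union
        (X-e , ∅-only (U - e)) (Δ-e , ∅-only (V - e)) (Γ , ∅-only W) V-e∩W≡∅
        (λ { ((f , e∉F) , F≢⊥) → Sum.map (λ d → (d , e∉F) , F≢⊥) (_, F≢⊥) (split f) })
        (λ { ((d , e∉F) , F≢⊥) → (left d , e∉F) , F≢⊥ })
        (λ { (g , F≢⊥) → (right g , Γ-avoids g) , F≢⊥ }) proj₂ proj₂

      -- The contraction contains the empty face because {e} is a face of Δ, and by disjointness it
      -- contains no nonempty face of Γ. So the part coming from Γ is Γ without its empty face, the
      -- same summand as in `reduced-union` and `reduced-deletion`.
      relative-union : ∀ k l → multiplicity (X-e , X/e) (k ⊖ 1) l ≡
                       multiplicity (Δ-e , Δ/e) (k ⊖ 1) l ℕ.+ multiplicity (Γ , ∅-only W) (k ⊖ 1) l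
      relative-union = multiplicity-disjoint-union (X-e , X/e) (Δ-e , Δ/e) (Γ , ∅-only W) V-e∩W≡∅
        (λ { ((f , e∉F) , ¬c) → Sum.map (λ d → (d , e∉F) , ¬c ∘ contraction⇐)
               (λ g → g , λ { ≡.refl → ¬c (contraction⇐ ⊥∈Δ/e) }) (split f) })
        (λ { ((d , e∉F) , ¬c) → (left d , e∉F) , ¬c ∘ contraction⇒ })
        (λ { (g , F≢⊥) → (right g , Γ-avoids g) , λ c → F≢⊥ (Γ∩Δ/e g (contraction⇒ c)) })
        (λ { (_ , ¬c) ≡.refl → ¬c ⊥∈Δ/e }) proj₂

      contraction-union : ∀ k l → multiplicity (X/e , ∅ᶜ (U - e)) (k ⊖ 1) l ≡
                                  multiplicity (Δ/e , ∅ᶜ (V - e)) (k ⊖ 1) l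
      contraction-union k l = multiplicity-cong (X/e , ∅ᶜ (U - e)) k l (Δ/e , ∅ᶜ (V - e))
        (λ { _ _ (f , _) → contraction⇒ f , λ () }) (λ { _ _ (f , _) → contraction⇐ f , λ () })

      relative-⊥ : ∀ l → multiplicity (X-e , X/e) (0 ⊖ 1) l ≡ 0
      relative-⊥ l = multiplicity-unsupported (X-e , X/e) 0 l
        λ { F ∣F∣≡0 (_ , ¬c) → ¬c (≡.subst (Face X/e) (≡.sym (∣p∣≡0⇒p≡⊥ ∣F∣≡0)) (contraction⇐ ⊥∈Δ/e)) }

    -- The union is an arbitrary complex `X` with the right faces, so that the argument also applies
    -- with Δ and Γ exchanged although the two unions have different vertex sets as expressions.
    recursion-disjoint-union : SpectralRecursionAt Δ e → SpectralRecursionAt X e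
    -- In degree -1 the contraction term is zero because of the factor t, and the relative term
    -- because the pair lacks the empty face. What remains is the shift of the vertex count by one.
    recursion-disjoint-union recΔ zero l =
      ≡.trans (≡.cong +_ (multiplicity₋₁-deletion X (left e∈Δ) l)) (≡.sym (≡.trans
        (≡.cong₂ (λ r r′ → + multiplicity (X-e , ∅ᶜ (U - e)) (0 ⊖ 1) (l + - 1#) ℤ.+ ℤ.0ℤ ℤ.+ (+ r ℤ.- + r′))
          (relative-⊥ l) (relative-⊥ (l + - 1#)))
        (≡.trans (ℤ.+-identityʳ _) (ℤ.+-identityʳ _))))
    recursion-disjoint-union recΔ (suc zero) l = ≡.trans
      (combine (+ d) (+ d′) (+ g l) (+ g l′) (+ p) (+ r l) (+ r l′) (+ x ℤ.- + y) union-0 deletion-0 (recΔ 1 l))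
      (assemble {a = multiplicity (X-e , ∅ᶜ (U - e)) (1 ⊖ 1) l′} (contraction-union 0 l′) (relative-union 1 l) (relative-union 1 l′))
      where
      l′ = l + - 1#
      g : Carrier → ℕ
      g = multiplicity (Γ , ∅-only W) (1 ⊖ 1)
      d = multiplicity (Δ , ∅ᶜ V) (1 ⊖ 1) l
      d′ = multiplicity (Δ-e , ∅ᶜ (V - e)) (1 ⊖ 1) l′
      p = multiplicity (Δ/e , ∅ᶜ (V - e)) (0 ⊖ 1) l′
      r : Carrier → ℕ
      r = multiplicity (Δ-e , Δ/e) (1 ⊖ 1)
      x = multiplicity (X , ∅ᶜ U) (0 ⊖ 1) l
      y = multiplicity (Δ , ∅ᶜ V) (0 ⊖ 1) l
      union-0 : + multiplicity (X , ∅ᶜ U) (1 ⊖ 1) l ≡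
                + (d ℕ.+ g l) ℤ.+ (+ x ℤ.- + y)
      union-0 = eliminate (+ d) (+ multiplicity (Δ , ∅-only V) (1 ⊖ 1) l) (+ g l) (+ x) (+ y) (+ indicator (l ≟ 0#))
        (≡.cong +_ (≡.trans (multiplicity₀ X (left ⊥∈Δ) l) (≡.cong (ℕ._+ x) (reduced-union 1 l))))
        (≡.cong +_ (multiplicity₀ Δ ⊥∈Δ l))
      deletion-0 : + multiplicity (X-e , ∅ᶜ (U - e)) (1 ⊖ 1) l′ ≡
                   + (d′ ℕ.+ g l′) ℤ.+ (+ x ℤ.- + y)
      deletion-0 = ≡.trans
        (eliminate (+ d′) (+ multiplicity (Δ-e , ∅-only (V - e)) (1 ⊖ 1) l′) (+ g l′)
          (+ multiplicity (X-e , ∅ᶜ (U - e)) (0 ⊖ 1) l′) (+ multiplicity (Δ-e , ∅ᶜ (V - e)) (0 ⊖ 1) l′)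
          (+ indicator (l′ ≟ 0#))
          (≡.cong +_ (≡.trans (multiplicity₀ X-e (left ⊥∈Δ , ∉⊥) l′)
                              (≡.cong (ℕ._+ multiplicity (X-e , ∅ᶜ (U - e)) (0 ⊖ 1) l′) (reduced-deletion 1 l′))))
          (≡.cong +_ (multiplicity₀ Δ-e (⊥∈Δ , ∉⊥) l′)))
        -- The corrections of the two deletions at l - 1 are rewritten as those of `X` and Δ at l,
        -- so that `combine` receives the same `w` twice.
        (≡.sym (≡.cong₂ (λ x y → + (d′ ℕ.+ g l′) ℤ.+ (+ x ℤ.- + y))
          (multiplicity₋₁-deletion X (left e∈Δ) l) (multiplicity₋₁-deletion Δ e∈Δ l)))
    recursion-disjoint-union recΔ (suc (suc k)) l = ≡.trans
      (combine (+ d) (+ d′) (+ g l) (+ g l′) (+ p) (+ r l) (+ r l′) ℤ.0ℤ union-+ deletion-+ (recΔ (2 ℕ.+ k) l))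
      (assemble {a = multiplicity (X-e , ∅ᶜ (U - e)) (2 ℕ.+ k ⊖ 1) l′} (contraction-union (suc k) l′) (relative-union (2 ℕ.+ k) l) (relative-union (2 ℕ.+ k) l′))
      where
      l′ = l + - 1#
      g : Carrier → ℕ
      g = multiplicity (Γ , ∅-only W) (2 ℕ.+ k ⊖ 1)
      d = multiplicity (Δ , ∅ᶜ V) (2 ℕ.+ k ⊖ 1) l
      d′ = multiplicity (Δ-e , ∅ᶜ (V - e)) (2 ℕ.+ k ⊖ 1) l′
      p = multiplicity (Δ/e , ∅ᶜ (V - e)) (1 ℕ.+ k ⊖ 1) l′
      r : Carrier → ℕ
      r = multiplicity (Δ-e , Δ/e) (2 ℕ.+ k ⊖ 1)
      union-+ : + multiplicity (X , ∅ᶜ U) (2 ℕ.+ k ⊖ 1) l ≡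
                + (d ℕ.+ g l) ℤ.+ ℤ.0ℤ
      union-+ = ≡.trans
        (≡.cong +_ (≡.trans (multiplicity₊ X k l) (≡.trans (reduced-union (2 ℕ.+ k) l)
          (≡.cong (ℕ._+ g l) (≡.sym (multiplicity₊ Δ k l))))))
        (≡.sym (ℤ.+-identityʳ _))
      deletion-+ : + multiplicity (X-e , ∅ᶜ (U - e)) (2 ℕ.+ k ⊖ 1) l′ ≡
                   + (d′ ℕ.+ g l′) ℤ.+ ℤ.0ℤ
      deletion-+ = ≡.trans
        (≡.cong +_ (≡.trans (multiplicity₊ X-e k l′) (≡.trans (reduced-deletion (2 ℕ.+ k) l′)
          (≡.cong (ℕ._+ g l′) (≡.sym (multiplicity₊ Δ-e k l′))))))
        (≡.sym (ℤ.+-identityʳ _))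

corollary6p11 : (ℝ : CompleteOrderedField) → let open Spectrum ℝ in
    {N : ℕ} {V W : Subset N} (Δ : Complex V) (Γ : Complex W) →
    Empty (V ∩ W) →
    SpectralRecursion Δ → SpectralRecursion Γ →
    SpectralRecursion (Δ ∪ᶜ Γ)
corollary6p11 ℝ {V = V} {W} Δ Γ V∩W≡∅ recΔ recΓ e _ with Face? Δ ⁅ e ⁆ | Face? Γ ⁅ e ⁆
... | yes e∈Δ | _ = recursion-disjoint-union (Δ ∪ᶜ Γ) Δ Γ V∩W≡∅ id inj₁ inj₂ e∈Δ
  (recΔ e (face⊆V Δ e∈Δ (x∈⁅x⁆ e)))
  where open Recursion ℝ
-- The complex is still the given union; only the decomposition of its faces is swapped.
... | no _ | yes e∈Γ = recursion-disjoint-union (Δ ∪ᶜ Γ) Γ Δ (≡.subst Empty (∩-comm V W) V∩W≡∅)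
  Sum.swap inj₂ inj₁ e∈Γ (recΓ e (face⊆V Γ e∈Γ (x∈⁅x⁆ e)))
  where open Recursion ℝ
... | no e∉Δ | no e∉Γ = recursion-loop (Δ ∪ᶜ Γ) Sum.[ e∉Δ , e∉Γ ]
  where open Recursion ℝ
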